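{- Let $\mathscr{X}_{2.1}$ be the set of digraphs $D$ with $S_D\mathbf{1} > \mathbf{0}$, and let $\mathscr{X}_{2.3}$ be the set of digraphs $D$ for which there is no non-zero weight vector $\mathbf{w}$ on $D$ with $S_D\mathbf{w}\leq\mathbf{0}$. Then every minimal member of $\mathscr{X}_{2.3}$ is smaller than every minimal member of $\mathscr{X}_{2.1}$; that is, it has strictly fewer arcs.
   Context: A digraph is a finite directed graph with at least one vertex whose underlying graph is simple, i.e. it has no loops and there is at most one arc between any two distinct vertices (in particular no pair of opposite arcs). For vertices $u,v$ of a digraph $D$, $d(u,v)$ is the length of a shortest directed path from $u$ to $v$ in $D$ (with $d(u,v)=\infty$ if there is none). If $V(D)=\{v_1,\dots,v_n\}$, the second-neighborhood matrix $S_D=(s_{ij})$ is the $n\times n$ real matrix with $s_{ij}=1$ if $d(v_i,v_j)=1$, $s_{ij}=-1$ if $d(v_i,v_j)=2$, and $s_{ij}=0$ otherwise. A weight vector on $D$ is a real vector indexed by $V(D)$ with all components in $[0,\infty)$. $\mathbf{0}$ and $\mathbf{1}$ denote the all-zeros and all-ones vectors. For vectors, $\mathbf{u}\leq\mathbf{v}$ and $\mathbf{u}>\mathbf{v}$ mean that the relation holds in every component. The words "minimal" and "smaller" refer to the number of arcs: a member of a set of digraphs is minimal if no member of that set has fewer arcs. -}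

module Defs where

open import Algebra.Bundles.Raw using (RawMonoid)
import Algebra.Definitions.RawMonoid as RawMonoidDefinitions
open import Data.Fin.Base using (Fin)
import Data.Fin.Properties as Fin
open import Data.List.Base using (List; length; filter; cartesianProduct; allFin)
open import Data.Nat.Base as ℕ using (ℕ; zero; suc)
import Data.Nat.Properties as ℕ
open import Data.Product.Base using (∃; ∃-syntax; _×_; _,_)
open import Data.Rational.Base as ℚ using (ℚ; 0ℚ; 1ℚ; ½; ∣_∣; 1/_)
import Data.Rational.Properties as ℚ
open import Data.Rational.Solver using (module +-*-Solver)
open import Data.Vec.Base as Vec using (Vec; []; _∷_)
open import Data.Vec.Functional using (Vector; replicate)
open import Data.Vec.Functional.Relation.Binary.Pointwise using (Pointwise)
open import Data.Vec.Relation.Unary.Linked using (Linked; linked?)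
open import Data.Vec.Relation.Unary.AllPairs using (allPairs?)
open import Data.Vec.Relation.Unary.Unique.Propositional using (Unique)
open import Data.Bool.Base using (if_then_else_)
open import Level using (0ℓ) renaming (suc to lsuc)
open import Relation.Binary.Core using (Rel)
open import Relation.Binary.Definitions using (Decidable; Irreflexive; Asymmetric)
open import Relation.Binary.PropositionalEquality
  using (_≡_; refl; sym; cong; subst; module ≡-Reasoning)
open import Relation.Nullary.Decidable
  using (Dec; does; map′; ¬?; _×-dec_)
open import Relation.Nullary.Negation using (¬_)
open import Relation.Unary using (Pred)
import Relation.Unary as Unary

------------------------------------------------------------------------
-- Real numbers

-- A real number is presented by a Cauchy sequence of rationals. Two
-- sequences present the same real number when they are related by _≈_
-- below, and every notion used is invariant under _≈_.

IsCauchy : Pred (ℕ → ℚ) 0ℓ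
IsCauchy x = ∀ ε → 0ℚ ℚ.< ε →
  ∃[ N ] (∀ m n → N ℕ.≤ m → N ℕ.≤ n → ∣ x m ℚ.- x n ∣ ℚ.≤ ε)

record ℝ : Set where
  constructor mkℝ
  field
    seq      : ℕ → ℚ
    isCauchy : IsCauchy seq

open ℝ public

infix 4 _≤_ _<_ _>_ _≈_

_≤_ : Rel ℝ 0ℓ
x ≤ y = ∀ ε → 0ℚ ℚ.< ε → ∃[ N ] (∀ n → N ℕ.≤ n → seq x n ℚ.≤ seq y n ℚ.+ ε)

-- The gap ε must be uniform: pointwise _<_ of the sequences, even
-- eventually, would not imply that the limits are distinct.
_<_ : Rel ℝ 0ℓ
x < y = ∃[ ε ] (0ℚ ℚ.< ε × ∃[ N ] (∀ n → N ℕ.≤ n → seq x n ℚ.+ ε ℚ.≤ seq y n))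

_>_ : Rel ℝ 0ℓ
x > y = y < x

_≈_ : Rel ℝ 0ℓ
x ≈ y = x ≤ y × y ≤ x

private
  0<p+q : ∀ {p q} → 0ℚ ℚ.< p → 0ℚ ℚ.< q → 0ℚ ℚ.< p ℚ.+ q
  0<p+q = ℚ.+-mono-<

  0<p*q : ∀ {p q} → 0ℚ ℚ.< p → 0ℚ ℚ.< q → 0ℚ ℚ.< p ℚ.* q
  0<p*q {p} {q} 0<p 0<q = subst (ℚ._< p ℚ.* q) (ℚ.*-zeroʳ p)
    (ℚ.*-monoʳ-<-pos p {{ℚ.positive 0<p}} 0<q)

  const-cauchy : ∀ p → IsCauchy (λ _ → p)
  const-cauchy p ε 0<ε = 0 , λ _ _ _ _ →
    subst (λ q → ∣ q ∣ ℚ.≤ ε) (sym (ℚ.+-inverseʳ p)) (ℚ.<⇒≤ 0<ε)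

  neg-cauchy : ∀ x → IsCauchy x → IsCauchy (λ n → ℚ.- x n)
  neg-cauchy x cx ε 0<ε with N , h ← cx ε 0<ε = N , λ m n N≤m N≤n →
    subst (ℚ._≤ ε) (sym (eq (x m) (x n))) (h m n N≤m N≤n)
    where
    open +-*-Solver
    eq : ∀ p q → ∣ ℚ.- p ℚ.- (ℚ.- q) ∣ ≡ ∣ p ℚ.- q ∣
    eq p q = begin
      ∣ ℚ.- p ℚ.- (ℚ.- q) ∣
        ≡⟨ cong ∣_∣ (solve 2 (λ a b → :- a :- (:- b) := :- (a :- b)) refl p q) ⟩
      ∣ ℚ.- (p ℚ.- q) ∣
        ≡⟨ ℚ.∣-p∣≡∣p∣ (p ℚ.- q) ⟩
      ∣ p ℚ.- q ∣ ∎
      where open ≡-Reasoning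

  +-cauchy : ∀ x y → IsCauchy x → IsCauchy y → IsCauchy (λ n → x n ℚ.+ y n)
  +-cauchy x y cx cy ε 0<ε
    with N , h ← cx (½ ℚ.* ε) (0<p*q (ℚ.positive⁻¹ ½) 0<ε)
       | M , k ← cy (½ ℚ.* ε) (0<p*q (ℚ.positive⁻¹ ½) 0<ε)
    = N ℕ.⊔ M , λ m n p q → begin
      ∣ x m ℚ.+ y m ℚ.- (x n ℚ.+ y n) ∣
        ≡⟨ cong ∣_∣ (solve 4 (λ a b c d → a :+ b :- (c :+ d) := (a :- c) :+ (b :- d))
             refl (x m) (y m) (x n) (y n)) ⟩
      ∣ (x m ℚ.- x n) ℚ.+ (y m ℚ.- y n) ∣
        ≤⟨ ℚ.∣p+q∣≤∣p∣+∣q∣ (x m ℚ.- x n) (y m ℚ.- y n) ⟩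
      ∣ x m ℚ.- x n ∣ ℚ.+ ∣ y m ℚ.- y n ∣
        ≤⟨ ℚ.+-mono-≤ (h m n (ℕ.m⊔n≤o⇒m≤o N M p) (ℕ.m⊔n≤o⇒m≤o N M q))
                      (k m n (ℕ.m⊔n≤o⇒n≤o N M p) (ℕ.m⊔n≤o⇒n≤o N M q)) ⟩
      ½ ℚ.* ε ℚ.+ ½ ℚ.* ε
        ≡⟨ sym (ℚ.*-distribʳ-+ ε ½ ½) ⟩
      1ℚ ℚ.* ε
        ≡⟨ ℚ.*-identityˡ ε ⟩
      ε ∎
    where
    open ℚ.≤-Reasoning
    open +-*-Solver

  bounded : ∀ x → IsCauchy x →
    ∃[ B ] (0ℚ ℚ.< B × ∃[ N ] (∀ n → N ℕ.≤ n → ∣ x n ∣ ℚ.≤ B))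
  bounded x cx with N , h ← cx 1ℚ (ℚ.positive⁻¹ 1ℚ) =
    1ℚ ℚ.+ ∣ x N ∣ , ℚ.+-mono-<-≤ (ℚ.positive⁻¹ 1ℚ) (ℚ.0≤∣p∣ (x N)) , N , λ n N≤n → begin
      ∣ x n ∣
        ≡⟨ cong ∣_∣ (solve 2 (λ a b → a := a :- b :+ b) refl (x n) (x N)) ⟩
      ∣ x n ℚ.- x N ℚ.+ x N ∣
        ≤⟨ ℚ.∣p+q∣≤∣p∣+∣q∣ (x n ℚ.- x N) (x N) ⟩
      ∣ x n ℚ.- x N ∣ ℚ.+ ∣ x N ∣
        ≤⟨ ℚ.+-monoˡ-≤ ∣ x N ∣ (h n N N≤n ℕ.≤-refl) ⟩
      1ℚ ℚ.+ ∣ x N ∣ ∎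
    where
    open ℚ.≤-Reasoning
    open +-*-Solver

  *-mono-∣∣ : ∀ p q {r s} → ∣ p ∣ ℚ.≤ r → ∣ q ∣ ℚ.≤ s → ∣ p ℚ.* q ∣ ℚ.≤ r ℚ.* s
  *-mono-∣∣ p q {r} {s} p≤r q≤s = begin
    ∣ p ℚ.* q ∣       ≡⟨ ℚ.∣p*q∣≡∣p∣*∣q∣ p q ⟩
    ∣ p ∣ ℚ.* ∣ q ∣   ≤⟨ ℚ.*-monoʳ-≤-nonNeg ∣ q ∣ {{ℚ.∣-∣-nonNeg q}} p≤r ⟩
    r ℚ.* ∣ q ∣       ≤⟨ ℚ.*-monoˡ-≤-nonNeg r
                           {{ℚ.nonNegative (ℚ.≤-trans (ℚ.0≤∣p∣ p) p≤r)}} q≤s ⟩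
    r ℚ.* s           ∎
    where open ℚ.≤-Reasoning

  *-difference : ∀ a b c d → a ℚ.* b ℚ.- c ℚ.* d ≡ a ℚ.* (b ℚ.- d) ℚ.+ d ℚ.* (a ℚ.- c)
  *-difference = solve 4 (λ a b c d →
      a :* b :- c :* d := a :* (b :- d) :+ d :* (a :- c)) refl
    where open +-*-Solver

  *-close : ∀ a b c d {B C δ} →
    ∣ a ∣ ℚ.≤ B → ∣ d ∣ ℚ.≤ C → ∣ a ℚ.- c ∣ ℚ.≤ δ → ∣ b ℚ.- d ∣ ℚ.≤ δ →
    ∣ a ℚ.* b ℚ.- c ℚ.* d ∣ ℚ.≤ (B ℚ.+ C) ℚ.* δ
  *-close a b c d {B} {C} {δ} a≤B d≤C a-c≤δ b-d≤δ = begin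
    ∣ a ℚ.* b ℚ.- c ℚ.* d ∣
      ≡⟨ cong ∣_∣ (*-difference a b c d) ⟩
    ∣ a ℚ.* (b ℚ.- d) ℚ.+ d ℚ.* (a ℚ.- c) ∣
      ≤⟨ ℚ.∣p+q∣≤∣p∣+∣q∣ (a ℚ.* (b ℚ.- d)) (d ℚ.* (a ℚ.- c)) ⟩
    ∣ a ℚ.* (b ℚ.- d) ∣ ℚ.+ ∣ d ℚ.* (a ℚ.- c) ∣
      ≤⟨ ℚ.+-mono-≤ (*-mono-∣∣ a (b ℚ.- d) a≤B b-d≤δ) (*-mono-∣∣ d (a ℚ.- c) d≤C a-c≤δ) ⟩
    B ℚ.* δ ℚ.+ C ℚ.* δ
      ≡⟨ sym (ℚ.*-distribʳ-+ δ B C) ⟩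
    (B ℚ.+ C) ℚ.* δ ∎
    where open ℚ.≤-Reasoning

  divide : ∀ B ε → 0ℚ ℚ.< B → 0ℚ ℚ.< ε → ∃[ δ ] (0ℚ ℚ.< δ × B ℚ.* δ ≡ ε)
  divide B ε 0<B 0<ε = 1/ B ℚ.* ε , 0<p*q (ℚ.positive⁻¹ (1/ B) {{ℚ.1/pos⇒pos B}}) 0<ε , (begin
    B ℚ.* (1/ B ℚ.* ε)   ≡⟨ sym (ℚ.*-assoc B (1/ B) ε) ⟩
    B ℚ.* 1/ B ℚ.* ε     ≡⟨ cong (ℚ._* ε) (ℚ.*-inverseʳ B) ⟩
    1ℚ ℚ.* ε             ≡⟨ ℚ.*-identityˡ ε ⟩
    ε                    ∎)
    where
    open ≡-Reasoning
    instance
      pos : ℚ.Positive B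
      pos = ℚ.positive 0<B
      nonZero : ℚ.NonZero B
      nonZero = ℚ.pos⇒nonZero B

  *-cauchy : ∀ x y → IsCauchy x → IsCauchy y → IsCauchy (λ n → x n ℚ.* y n)
  *-cauchy x y cx cy ε 0<ε =
    let B , 0<B , N₁ , b = bounded x cx
        C , 0<C , N₂ , c = bounded y cy
        δ , 0<δ , eq     = divide (B ℚ.+ C) ε (0<p+q 0<B 0<C) 0<ε
        N₃ , h           = cx δ 0<δ
        N₄ , k           = cy δ 0<δ
    in (N₁ ℕ.⊔ N₂) ℕ.⊔ (N₃ ℕ.⊔ N₄) , λ m n p q →
      let p₁₂ = ℕ.m⊔n≤o⇒m≤o (N₁ ℕ.⊔ N₂) (N₃ ℕ.⊔ N₄) p
          q₁₂ = ℕ.m⊔n≤o⇒m≤o (N₁ ℕ.⊔ N₂) (N₃ ℕ.⊔ N₄) q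
          p₃₄ = ℕ.m⊔n≤o⇒n≤o (N₁ ℕ.⊔ N₂) (N₃ ℕ.⊔ N₄) p
          q₃₄ = ℕ.m⊔n≤o⇒n≤o (N₁ ℕ.⊔ N₂) (N₃ ℕ.⊔ N₄) q
      in ℚ.≤-trans
           (*-close (x m) (y m) (x n) (y n)
             (b m (ℕ.m⊔n≤o⇒m≤o N₁ N₂ p₁₂))
             (c n (ℕ.m⊔n≤o⇒n≤o N₁ N₂ q₁₂))
             (h m n (ℕ.m⊔n≤o⇒m≤o N₃ N₄ p₃₄) (ℕ.m⊔n≤o⇒m≤o N₃ N₄ q₃₄))
             (k m n (ℕ.m⊔n≤o⇒n≤o N₃ N₄ p₃₄) (ℕ.m⊔n≤o⇒n≤o N₃ N₄ q₃₄)))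
           (ℚ.≤-reflexive eq)

infixl 6 _+_
infixl 7 _*_
infix  8 -_

fromℚ : ℚ → ℝ
fromℚ p = mkℝ (λ _ → p) (const-cauchy p)

0ℝ 1ℝ : ℝ
0ℝ = fromℚ 0ℚ
1ℝ = fromℚ 1ℚ

_+_ : ℝ → ℝ → ℝ
x + y = mkℝ (λ n → seq x n ℚ.+ seq y n) (+-cauchy (seq x) (seq y) (isCauchy x) (isCauchy y))

-_ : ℝ → ℝ
- x = mkℝ (λ n → ℚ.- seq x n) (neg-cauchy (seq x) (isCauchy x))

_*_ : ℝ → ℝ → ℝ
x * y = mkℝ (λ n → seq x n ℚ.* seq y n) (*-cauchy (seq x) (seq y) (isCauchy x) (isCauchy y))

+-0-rawMonoid : RawMonoid 0ℓ 0ℓ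
+-0-rawMonoid = record { Carrier = ℝ ; _≈_ = _≈_ ; _∙_ = _+_ ; ε = 0ℝ }

open RawMonoidDefinitions +-0-rawMonoid using (sum)

Matrix : ℕ → ℕ → Set
Matrix m n = Fin m → Fin n → ℝ

infixr 7 _*ᵥ_

_*ᵥ_ : ∀ {m n} → Matrix m n → Vector ℝ n → Vector ℝ m
(A *ᵥ w) i = sum (λ j → A i j * w j)

𝟎 𝟏 : ∀ {n} → Vector ℝ n
𝟎 = replicate _ 0ℝ
𝟏 = replicate _ 1ℝ

------------------------------------------------------------------------
-- Digraphs

-- The vertex set is labelled as Fin order. Asymmetry of the arc relation
-- says that any two vertices are joined by at most one arc.
record Digraph : Set₁ where
  infix 4 _⟶_ _⟶?_
  field
    order       : ℕ
    {{nonEmpty}} : ℕ.NonZero order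
    _⟶_         : Rel (Fin order) 0ℓ
    _⟶?_        : Decidable _⟶_
    irrefl      : Irreflexive _≡_ _⟶_
    asym        : Asymmetric _⟶_

  Vertex : Set
  Vertex = Fin order

  arcs : List (Vertex × Vertex)
  arcs = filter (λ (u , v) → u ⟶? v) (cartesianProduct (allFin order) (allFin order))

  size : ℕ
  size = length arcs

-- A directed path of length k visits k + 1 distinct vertices.
module _ (D : Digraph) where
  open Digraph D

  IsPath : ∀ {k} → Vertex → Vertex → Pred (Vec Vertex (suc k)) 0ℓ
  IsPath u v p = Vec.head p ≡ u × Vec.last p ≡ v × Linked _⟶_ p × Unique p

  HasPath : ℕ → Rel Vertex 0ℓ
  HasPath k u v = ∃ λ (p : Vec Vertex (suc k)) → IsPath u v p

  -- Dist k u v states d(u,v) = k; d(u,v) = ∞ when Dist k u v fails for all k.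
  Dist : ℕ → Rel Vertex 0ℓ
  Dist k u v = HasPath k u v × (∀ {j} → j ℕ.< k → ¬ HasPath j u v)

  private
    anyVec? : ∀ {n k} {P : Pred (Vec (Fin n) k) 0ℓ} → Unary.Decidable P → Dec (∃ P)
    anyVec? {k = zero}  P? = map′ (λ p → [] , p) (λ { ([] , p) → p }) (P? [])
    anyVec? {k = suc k} P? = map′
      (λ (x , xs , p) → x ∷ xs , p) (λ { (x ∷ xs , p) → x , xs , p })
      (Fin.any? λ x → anyVec? λ xs → P? (x ∷ xs))

  hasPath? : ∀ k → Decidable (HasPath k)
  hasPath? k u v = anyVec? λ p →
    (Vec.head p Fin.≟ u) ×-dec (Vec.last p Fin.≟ v) ×-dec
    linked? _⟶?_ p ×-dec allPairs? (λ x y → ¬? (x Fin.≟ y)) p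

  dist? : ∀ k → Decidable (Dist k)
  dist? k u v = hasPath? k u v ×-dec ℕ.allUpTo? (λ j → ¬? (hasPath? j u v)) k

  secondNeighborhoodMatrix : Matrix order order
  secondNeighborhoodMatrix u v =
    if does (dist? 1 u v) then 1ℝ else
    if does (dist? 2 u v) then - 1ℝ else 0ℝ

  WeightVector : Pred (Vector ℝ order) 0ℓ
  WeightVector w = Pointwise _≤_ 𝟎 w

  NonZeroVector : Pred (Vector ℝ order) 0ℓ
  NonZeroVector w = ¬ Pointwise _≈_ w 𝟎

------------------------------------------------------------------------

𝒳₂₁ : Pred Digraph 0ℓ
𝒳₂₁ D = Pointwise _>_ (secondNeighborhoodMatrix D *ᵥ 𝟏) 𝟎

𝒳₂₃ : Pred Digraph 0ℓ
𝒳₂₃ D = ¬ ∃ λ w → WeightVector D w × NonZeroVector D w ×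
                  Pointwise _≤_ (secondNeighborhoodMatrix D *ᵥ w) 𝟎

Minimal : Pred Digraph 0ℓ → Pred Digraph (lsuc 0ℓ)
Minimal 𝒳 D = 𝒳 D × (∀ E → 𝒳 E → Digraph.size D ℕ.≤ Digraph.size E)

SmallerThan : Rel Digraph 0ℓ
SmallerThan D E = Digraph.size D ℕ.< Digraph.size E

{-# OPTIONS --safe #-}
-- By linear duality D lies in 𝒳₂₃ as soon as yᵀ S_D > 0 for some weights y ≥ 0.
-- As S of the reverse digraph is the transpose, it suffices to find, for E in
-- 𝒳₂₁, a digraph with fewer arcs and weights y ≥ 0 with S y > 0. Let u have
-- maximum out-degree in E, let u ⟶ v, and let q = s_u − 2 e_v, which bounds row u
-- of S from below once u ⟶ v is deleted. With N = q · q the weights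
-- y = (2N + 1) 𝟏 + 2q − 2 e_v certify E − uv, unless some row s_x with sum 1
-- satisfies s_x · q = −N, that is, s_x = −q on the support of q. Counting
-- out-neighbours then gives N⁺⁺(x) ⊆ N⁺(u), while N⁺(u) ∪ N⁺⁺(u) ⊆ N⁺(x) ∪ N⁺⁺(x);
-- so N⁺(x) ∪ N⁺⁺(x) is closed under out-neighbours and misses x, and the
-- subdigraph it induces, with weights 𝟏, has fewer arcs than E.

module Submission where

open import Defs
import Algebra.Definitions.RawMonoid as RawMonoidDefinitions
import Algebra.Properties.Semiring.Sum as SemiringSum
open import Algebra.Bundles using (CommutativeRing)
open import Data.Bool.Base using (true; false; if_then_else_)
import Data.Fin.Base as Fin
open import Data.Fin.Base using (Fin; zero; suc)
import Data.Fin.Properties as Fin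
open import Data.Integer.Base as ℤ using (ℤ; 0ℤ; 1ℤ; -1ℤ)
import Data.Integer.Properties as ℤ
import Data.Integer.Tactic.RingSolver as ℤ
open import Data.List.Base as List using (List; length; allFin; cartesianProduct)
import Data.List.Extrema ℤ.≤-totalOrder as Extrema
open import Data.List.Membership.Propositional using (_∈_; _∉_)
open import Data.List.Membership.Propositional.Properties
  using (∈-allFin; ∈-cartesianProduct⁺; ∈-filter⁺; ∈-filter⁻; ∈-lookup; ∈-map⁻)
import Data.List.Properties as List
import Data.List.Relation.Unary.All as All
import Data.List.Relation.Unary.All.Properties as All
import Data.List.Relation.Unary.AllPairs as AllPairs
open import Data.List.Relation.Unary.Any as Any using (here; there)
import Data.List.Relation.Unary.Any.Properties as Any
import Data.List.Relation.Unary.Unique.Propositional as List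
import Data.List.Relation.Unary.Unique.Propositional.Properties as Unique
open import Data.Nat.Base as ℕ using (ℕ; zero; suc; z≤n; s≤s)
import Data.Nat.Properties as ℕ
open import Data.Product.Base using (∃; ∃-syntax; _×_; _,_; proj₁; proj₂)
open import Data.Rational.Base as ℚ using (ℚ; 0ℚ; 1ℚ; 1/_)
open import Data.Rational.Literals using (fromℤ)
import Data.Rational.Properties as ℚ
import Data.Rational.Unnormalised.Base as ℚᵘ
import Data.Rational.Unnormalised.Properties as ℚᵘ
open import Data.Vec.Base using ([]; _∷_)
open import Data.Vec.Functional using (Vector)
open import Data.Vec.Functional.Relation.Binary.Pointwise using (Pointwise)
open import Data.Vec.Relation.Unary.All using ([]; _∷_)
open import Data.Vec.Relation.Unary.AllPairs using ([]; _∷_)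
open import Data.Vec.Relation.Unary.Linked using ([-]; _∷_)
open import Function.Base using (_∘_; id)
open import Function.Definitions using (Injective)
open import Relation.Binary.PropositionalEquality
  using (_≡_; _≢_; refl; sym; trans; cong; cong₂; subst; module ≡-Reasoning)
open import Relation.Nullary.Decidable using (Dec; yes; no; does; ¬?; _×-dec_)
open import Relation.Nullary.Negation using (¬_; contradiction)

module ℝΣ = RawMonoidDefinitions +-0-rawMonoid
module ℤΣ = SemiringSum ℤ.+-*-semiring
module ℚΣ = SemiringSum (CommutativeRing.semiring ℚ.+-*-commutativeRing)

-- Sums of integers and of rationals

ℤ-sum-mono-≤ : ∀ {n} {f g : Vector ℤ n} → (∀ i → f i ℤ.≤ g i) → ℤΣ.sum f ℤ.≤ ℤΣ.sum g
ℤ-sum-mono-≤ {zero}  f≤g = ℤ.≤-refl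
ℤ-sum-mono-≤ {suc n} f≤g = ℤ.+-mono-≤ (f≤g zero) (ℤ-sum-mono-≤ (f≤g ∘ suc))

ℤ-sum-nonNeg : ∀ {n} {f : Vector ℤ n} → (∀ i → 0ℤ ℤ.≤ f i) → 0ℤ ℤ.≤ ℤΣ.sum f
ℤ-sum-nonNeg {zero}  0≤f = ℤ.≤-refl
ℤ-sum-nonNeg {suc n} 0≤f = ℤ.+-mono-≤ (0≤f zero) (ℤ-sum-nonNeg (0≤f ∘ suc))

ℤ-term≤sum : ∀ {n} {f : Vector ℤ n} → (∀ i → 0ℤ ℤ.≤ f i) → ∀ k → f k ℤ.≤ ℤΣ.sum f
ℤ-term≤sum {f = f} 0≤f zero = subst (ℤ._≤ ℤΣ.sum f) (ℤ.+-identityʳ (f zero))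
  (ℤ.+-monoʳ-≤ (f zero) (ℤ-sum-nonNeg (0≤f ∘ suc)))
ℤ-term≤sum {f = f} 0≤f (suc k) = subst (ℤ._≤ ℤΣ.sum f) (ℤ.+-identityˡ (f (suc k)))
  (ℤ.+-mono-≤ (0≤f zero) (ℤ-term≤sum (0≤f ∘ suc) k))

-- Shorter combinations use this too, padded with zero coefficients.
ℤ-sum-linear : ∀ {n} (a b c d : ℤ) (f g h k : Vector ℤ n) →
  ℤΣ.sum (λ i → a ℤ.* f i ℤ.+ b ℤ.* g i ℤ.+ c ℤ.* h i ℤ.+ d ℤ.* k i) ≡
  a ℤ.* ℤΣ.sum f ℤ.+ b ℤ.* ℤΣ.sum g ℤ.+ c ℤ.* ℤΣ.sum h ℤ.+ d ℤ.* ℤΣ.sum k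
ℤ-sum-linear {zero}  a b c d f g h k = zeros a b c d
  where
  zeros : ∀ a b c d → 0ℤ ≡ a ℤ.* 0ℤ ℤ.+ b ℤ.* 0ℤ ℤ.+ c ℤ.* 0ℤ ℤ.+ d ℤ.* 0ℤ
  zeros = ℤ.solve-∀
ℤ-sum-linear {suc n} a b c d f g h k = trans
  (cong (ℤ._+_ (a ℤ.* f zero ℤ.+ b ℤ.* g zero ℤ.+ c ℤ.* h zero ℤ.+ d ℤ.* k zero))
        (ℤ-sum-linear a b c d (f ∘ suc) (g ∘ suc) (h ∘ suc) (k ∘ suc)))
  (regroup a b c d (f zero) (g zero) (h zero) (k zero) _ _ _ _)
  where
  regroup : ∀ a b c d x y z w x′ y′ z′ w′ →
    (a ℤ.* x ℤ.+ b ℤ.* y ℤ.+ c ℤ.* z ℤ.+ d ℤ.* w) ℤ.+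
    (a ℤ.* x′ ℤ.+ b ℤ.* y′ ℤ.+ c ℤ.* z′ ℤ.+ d ℤ.* w′) ≡
    a ℤ.* (x ℤ.+ x′) ℤ.+ b ℤ.* (y ℤ.+ y′) ℤ.+ c ℤ.* (z ℤ.+ z′) ℤ.+ d ℤ.* (w ℤ.+ w′)
  regroup = ℤ.solve-∀

ℚ-sum-mono-≤ : ∀ {n} {f g : Vector ℚ n} → (∀ i → f i ℚ.≤ g i) → ℚΣ.sum f ℚ.≤ ℚΣ.sum g
ℚ-sum-mono-≤ {zero}  f≤g = ℚ.≤-refl
ℚ-sum-mono-≤ {suc n} f≤g = ℚ.+-mono-≤ (f≤g zero) (ℚ-sum-mono-≤ (f≤g ∘ suc))

ℚ-sum-nonNeg : ∀ {n} {f : Vector ℚ n} → (∀ i → 0ℚ ℚ.≤ f i) → 0ℚ ℚ.≤ ℚΣ.sum f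
ℚ-sum-nonNeg {zero}  0≤f = ℚ.≤-refl
ℚ-sum-nonNeg {suc n} 0≤f = ℚ.+-mono-≤ (0≤f zero) (ℚ-sum-nonNeg (0≤f ∘ suc))

ℚ-term≤sum : ∀ {n} {f : Vector ℚ n} → (∀ i → 0ℚ ℚ.≤ f i) → ∀ k → f k ℚ.≤ ℚΣ.sum f
ℚ-term≤sum {f = f} 0≤f zero = subst (ℚ._≤ ℚΣ.sum f) (ℚ.+-identityʳ (f zero))
  (ℚ.+-monoʳ-≤ (f zero) (ℚ-sum-nonNeg (0≤f ∘ suc)))
ℚ-term≤sum {f = f} 0≤f (suc k) = subst (ℚ._≤ ℚΣ.sum f) (ℚ.+-identityˡ (f (suc k)))
  (ℚ.+-mono-≤ (0≤f zero) (ℚ-term≤sum (0≤f ∘ suc) k))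

-- Embedding the integers in the rationals

fromℤ-+ : ∀ i j → fromℤ (i ℤ.+ j) ≡ fromℤ i ℚ.+ fromℤ j
fromℤ-+ i j = ℚ.toℚᵘ-injective (ℚᵘ.≃-trans (ℚᵘ.*≡* (eq i j))
  (ℚᵘ.≃-sym (ℚ.toℚᵘ-homo-+ (fromℤ i) (fromℤ j))))
  where
  eq : ∀ i j → (i ℤ.+ j) ℤ.* 1ℤ ≡ (i ℤ.* 1ℤ ℤ.+ j ℤ.* 1ℤ) ℤ.* 1ℤ
  eq = ℤ.solve-∀

fromℤ-* : ∀ i j → fromℤ (i ℤ.* j) ≡ fromℤ i ℚ.* fromℤ j
fromℤ-* i j = ℚ.toℚᵘ-injective (ℚᵘ.≃-trans (ℚᵘ.*≡* refl)
  (ℚᵘ.≃-sym (ℚ.toℚᵘ-homo-* (fromℤ i) (fromℤ j))))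

fromℤ-sum : ∀ {n} (f : Vector ℤ n) → fromℤ (ℤΣ.sum f) ≡ ℚΣ.sum (fromℤ ∘ f)
fromℤ-sum {zero}  f = refl
fromℤ-sum {suc n} f = trans (fromℤ-+ (f zero) _) (cong (fromℤ (f zero) ℚ.+_) (fromℤ-sum (f ∘ suc)))

fromℤ-mono-≤ : ∀ {i j} → i ℤ.≤ j → fromℤ i ℚ.≤ fromℤ j
fromℤ-mono-≤ i≤j = ℚ.*≤* (ℤ.*-monoʳ-≤-nonNeg 1ℤ i≤j)

0<fromℤ⇒1≤ : ∀ {i} → 0ℚ ℚ.< fromℤ i → 1ℤ ℤ.≤ i
0<fromℤ⇒1≤ {i} (ℚ.*<* 0<i) = ℤ.i<j⇒suc[i]≤j (subst (0ℤ ℤ.<_) (ℤ.*-identityʳ i) 0<i)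

-- Duality

*-nonNeg : ∀ {p q} → 0ℚ ℚ.≤ p → 0ℚ ℚ.≤ q → 0ℚ ℚ.≤ p ℚ.* q
*-nonNeg {p} {q} 0≤p 0≤q = subst (ℚ._≤ p ℚ.* q) (ℚ.*-zeroʳ p)
  (ℚ.*-monoˡ-≤-nonNeg p {{ℚ.nonNegative 0≤p}} 0≤q)

-- Summing the rows of A v ≤ δ with weights y gives c · v ≤ δ ∑ y, where c = yᵀ A.
dual-bound : ∀ {m n} (A : Fin m → Fin n → ℚ) (y : Vector ℚ m) (v : Vector ℚ n) (δ : ℚ) →
  (∀ i → 0ℚ ℚ.≤ y i) → (∀ j → 1ℚ ℚ.≤ ℚΣ.sum (λ i → y i ℚ.* A i j)) → 0ℚ ℚ.≤ δ →
  (∀ j → 0ℚ ℚ.≤ v j ℚ.+ δ) → (∀ i → ℚΣ.sum (λ j → A i j ℚ.* v j) ℚ.≤ δ) →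
  ∀ k → v k ℚ.≤ (ℚΣ.sum y ℚ.+ ℚΣ.sum (λ j → ℚΣ.sum (λ i → y i ℚ.* A i j))) ℚ.* δ
dual-bound {m} {n} A y v δ 0≤y 1≤c 0≤δ 0≤v+δ Av≤δ k = begin
  v k
    ≡⟨ ℚ.+-identityʳ (v k) ⟨
  -- Entries of `v` may be as low as `- δ`, so the estimate runs on the shifted, nonnegative vector;
  -- the shift costs the extra `ℚΣ.sum c ℚ.* δ`.
  v k ℚ.+ 0ℚ
    ≤⟨ ℚ.+-monoʳ-≤ (v k) 0≤δ ⟩
  v k ℚ.+ δ
    ≡⟨ ℚ.*-identityˡ (v k ℚ.+ δ) ⟨
  1ℚ ℚ.* (v k ℚ.+ δ)
    ≤⟨ ℚ.*-monoʳ-≤-nonNeg (v k ℚ.+ δ) {{ℚ.nonNegative (0≤v+δ k)}} (1≤c k) ⟩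
  c k ℚ.* (v k ℚ.+ δ)
    ≤⟨ ℚ-term≤sum (λ j → *-nonNeg (ℚ.≤-trans 0≤1 (1≤c j)) (0≤v+δ j)) k ⟩
  ℚΣ.sum (λ j → c j ℚ.* (v j ℚ.+ δ))
    ≡⟨ ℚΣ.sum-cong-≗ (λ j → ℚ.*-distribˡ-+ (c j) (v j) δ) ⟩
  ℚΣ.sum (λ j → c j ℚ.* v j ℚ.+ c j ℚ.* δ)
    ≡⟨ ℚΣ.∑-distrib-+ (λ j → c j ℚ.* v j) (λ j → c j ℚ.* δ) ⟩
  ℚΣ.sum (λ j → c j ℚ.* v j) ℚ.+ ℚΣ.sum (λ j → c j ℚ.* δ)
    ≡⟨ cong₂ ℚ._+_ exchange (sym (ℚΣ.*-distribʳ-sum δ c)) ⟩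
  ℚΣ.sum (λ i → y i ℚ.* ℚΣ.sum (λ j → A i j ℚ.* v j)) ℚ.+ ℚΣ.sum c ℚ.* δ
    ≤⟨ ℚ.+-monoˡ-≤ (ℚΣ.sum c ℚ.* δ) (ℚ-sum-mono-≤ λ i →
         ℚ.*-monoˡ-≤-nonNeg (y i) {{ℚ.nonNegative (0≤y i)}} (Av≤δ i)) ⟩
  ℚΣ.sum (λ i → y i ℚ.* δ) ℚ.+ ℚΣ.sum c ℚ.* δ
    ≡⟨ cong (ℚ._+ ℚΣ.sum c ℚ.* δ) (ℚΣ.*-distribʳ-sum δ y) ⟨
  ℚΣ.sum y ℚ.* δ ℚ.+ ℚΣ.sum c ℚ.* δ
    ≡⟨ ℚ.*-distribʳ-+ δ (ℚΣ.sum y) (ℚΣ.sum c) ⟨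
  (ℚΣ.sum y ℚ.+ ℚΣ.sum c) ℚ.* δ ∎
  where
  open ℚ.≤-Reasoning
  c : Vector ℚ n
  c j = ℚΣ.sum (λ i → y i ℚ.* A i j)
  0≤1 : 0ℚ ℚ.≤ 1ℚ
  0≤1 = ℚ.<⇒≤ (ℚ.positive⁻¹ 1ℚ)
  exchange : ℚΣ.sum (λ j → c j ℚ.* v j) ≡
             ℚΣ.sum (λ i → y i ℚ.* ℚΣ.sum (λ j → A i j ℚ.* v j))
  exchange = begin-equality
    ℚΣ.sum (λ j → c j ℚ.* v j)
      ≡⟨ ℚΣ.sum-cong-≗ (λ j → ℚΣ.*-distribʳ-sum (v j) (λ i → y i ℚ.* A i j)) ⟩
    ℚΣ.sum (λ j → ℚΣ.sum (λ i → y i ℚ.* A i j ℚ.* v j))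
      ≡⟨ ℚΣ.∑-comm (λ j i → y i ℚ.* A i j ℚ.* v j) ⟩
    ℚΣ.sum (λ i → ℚΣ.sum (λ j → y i ℚ.* A i j ℚ.* v j))
      ≡⟨ ℚΣ.sum-cong-≗ (λ i → trans
           (ℚΣ.sum-cong-≗ (λ j → ℚ.*-assoc (y i) (A i j) (v j)))
           (sym (ℚΣ.*-distribˡ-sum (y i) (λ j → A i j ℚ.* v j)))) ⟩
    ℚΣ.sum (λ i → y i ℚ.* ℚΣ.sum (λ j → A i j ℚ.* v j)) ∎

-- From real vectors to their rational approximations

seq-sum : ∀ {n} (f : Vector ℝ n) k → seq (ℝΣ.sum f) k ≡ ℚΣ.sum (λ i → seq (f i) k)
seq-sum {zero}  f k = refl
seq-sum {suc n} f k = cong (seq (f zero) k ℚ.+_) (seq-sum (f ∘ suc) k)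

eventually-∀ : ∀ {n} {P : Fin n → ℕ → Set} →
  (∀ i → ∃[ N ] (∀ k → N ℕ.≤ k → P i k)) → ∃[ N ] (∀ k → N ℕ.≤ k → ∀ i → P i k)
eventually-∀ {zero}  h = 0 , λ _ _ ()
eventually-∀ {suc n} h with N , p ← h zero | M , q ← eventually-∀ (h ∘ suc) =
  N ℕ.⊔ M , λ where
    k N⊔M≤k zero    → p k (ℕ.m⊔n≤o⇒m≤o N M N⊔M≤k)
    k N⊔M≤k (suc i) → q k (ℕ.m⊔n≤o⇒n≤o N M N⊔M≤k) i

module _ {n} (S : Matrix n n) (s : Fin n → Fin n → ℤ)
  (S≗s : ∀ u v k → seq (S u v) k ≡ fromℤ (s u v)) where

  seq-*ᵥ : ∀ w u k → seq ((S *ᵥ w) u) k ≡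
    ℚΣ.sum (λ v → fromℤ (s u v) ℚ.* seq (w v) k)
  seq-*ᵥ w u k = trans (seq-sum (λ v → S u v * w v) k)
    (ℚΣ.sum-cong-≗ λ v → cong (ℚ._* seq (w v) k) (S≗s u v k))

  -- The matrix entries are constant integer sequences, so a single index past the threshold of the
  -- gap shows the integer row sum to be positive.
  S𝟏>𝟎⇒rowSum≥1 : Pointwise _>_ (S *ᵥ 𝟏) 𝟎 → ∀ u → 1ℤ ℤ.≤ ℤΣ.sum (s u)
  S𝟏>𝟎⇒rowSum≥1 S𝟏>𝟎 u = 0<fromℤ⇒1≤ (gap (S𝟏>𝟎 u))
    where
    open ℚ.≤-Reasoning
    gap : (S *ᵥ 𝟏) u > 0ℝ → 0ℚ ℚ.< fromℤ (ℤΣ.sum (s u))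
    gap (ε , 0<ε , N , h) = begin-strict
      0ℚ
        <⟨ 0<ε ⟩
      ε
        ≡⟨ ℚ.+-identityˡ ε ⟨
      0ℚ ℚ.+ ε
        ≤⟨ h N ℕ.≤-refl ⟩
      seq ((S *ᵥ 𝟏) u) N
        ≡⟨ seq-*ᵥ 𝟏 u N ⟩
      ℚΣ.sum (λ v → fromℤ (s u v) ℚ.* 1ℚ)
        ≡⟨ ℚΣ.sum-cong-≗ (λ v → ℚ.*-identityʳ (fromℤ (s u v))) ⟩
      ℚΣ.sum (λ v → fromℤ (s u v))
        ≡⟨ fromℤ-sum (s u) ⟨
      fromℤ (ℤΣ.sum (s u)) ∎

  -- Far enough along the sequences the approximations of `w` are at least `- δ` and those of
  -- `S *ᵥ w` at most `δ`, so `dual-bound` caps every entry by a fixed multiple of `δ`. Hence `w` is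
  -- zero.
  yᵀS>𝟎⇒Sw≰𝟎 : (y : Fin n → ℤ) → (∀ u → 0ℤ ℤ.≤ y u) →
    (∀ v → 1ℤ ℤ.≤ ℤΣ.sum (λ u → y u ℤ.* s u v)) →
    ¬ ∃ λ w → Pointwise _≤_ 𝟎 w × (¬ Pointwise _≈_ w 𝟎) × Pointwise _≤_ (S *ᵥ w) 𝟎
  yᵀS>𝟎⇒Sw≰𝟎 y 0≤y 1≤c (w , 0≤w , w≉0 , Sw≤0) = w≉0 λ v → w≤0 v , 0≤w v
    where
    y′ : Vector ℚ n
    y′ u = fromℤ (y u)
    A : Fin n → Fin n → ℚ
    A u v = fromℤ (s u v)
    0≤y′ : ∀ u → 0ℚ ℚ.≤ y′ u
    0≤y′ u = fromℤ-mono-≤ (0≤y u)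
    c : Vector ℚ n
    c v = ℚΣ.sum (λ u → y′ u ℚ.* A u v)
    1≤c′ : ∀ v → 1ℚ ℚ.≤ c v
    1≤c′ v = subst (1ℚ ℚ.≤_)
      (trans (fromℤ-sum (λ u → y u ℤ.* s u v))
             (ℚΣ.sum-cong-≗ λ u → fromℤ-* (y u) (s u v)))
      (fromℤ-mono-≤ (1≤c v))
    B C : ℚ
    B = ℚΣ.sum y′ ℚ.+ ℚΣ.sum c
    -- The extra 1 makes `C` positive from `B ≥ 0` alone; then `B δ ≤ C δ = ε` for `δ = ε / C`.
    C = 1ℚ ℚ.+ B
    0<C : 0ℚ ℚ.< C
    0<C = ℚ.+-mono-<-≤ (ℚ.positive⁻¹ 1ℚ) (ℚ.+-mono-≤ (ℚ-sum-nonNeg 0≤y′)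
      (ℚ-sum-nonNeg λ v → ℚ.≤-trans (ℚ.<⇒≤ (ℚ.positive⁻¹ 1ℚ)) (1≤c′ v)))
    instance
      C-positive : ℚ.Positive C
      C-positive = ℚ.positive 0<C
      C-nonZero : ℚ.NonZero C
      C-nonZero = ℚ.pos⇒nonZero C
    w≤0 : ∀ v → w v ≤ 0ℝ
    w≤0 v ε 0<ε = N ℕ.⊔ M , λ k N⊔M≤k → begin
      seq (w v) k
        ≤⟨ dual-bound A y′ (λ x → seq (w x) k) δ 0≤y′ 1≤c′ (ℚ.<⇒≤ 0<δ)
             (lower k (ℕ.m⊔n≤o⇒m≤o N M N⊔M≤k))
             (λ x → begin
               ℚΣ.sum (λ z → A x z ℚ.* seq (w z) k)
                 ≡⟨ seq-*ᵥ w x k ⟨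
               seq ((S *ᵥ w) x) k
                 ≤⟨ upper k (ℕ.m⊔n≤o⇒n≤o N M N⊔M≤k) x ⟩
               0ℚ ℚ.+ δ
                 ≡⟨ ℚ.+-identityˡ δ ⟩
               δ ∎)
             v ⟩
      B ℚ.* δ
        ≡⟨ ℚ.+-identityˡ (B ℚ.* δ) ⟨
      0ℚ ℚ.+ B ℚ.* δ
        ≤⟨ ℚ.+-monoˡ-≤ (B ℚ.* δ) (ℚ.<⇒≤ 0<δ) ⟩
      δ ℚ.+ B ℚ.* δ
        ≡⟨ cong (ℚ._+ B ℚ.* δ) (ℚ.*-identityˡ δ) ⟨
      1ℚ ℚ.* δ ℚ.+ B ℚ.* δ
        ≡⟨ ℚ.*-distribʳ-+ δ 1ℚ B ⟨
      C ℚ.* δ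
        ≡⟨ ℚ.*-assoc C (1/ C) ε ⟨
      C ℚ.* 1/ C ℚ.* ε
        ≡⟨ cong (ℚ._* ε) (ℚ.*-inverseʳ C) ⟩
      1ℚ ℚ.* ε
        ≡⟨ ℚ.*-identityˡ ε ⟩
      ε
        ≡⟨ ℚ.+-identityˡ ε ⟨
      0ℚ ℚ.+ ε ∎
      where
      open ℚ.≤-Reasoning
      δ : ℚ
      δ = 1/ C ℚ.* ε
      0<δ : 0ℚ ℚ.< δ
      0<δ = subst (ℚ._< δ) (ℚ.*-zeroʳ (1/ C))
        (ℚ.*-monoʳ-<-pos (1/ C) {{ℚ.1/pos⇒pos C}} 0<ε)
      N×lower = eventually-∀ λ x → 0≤w x δ 0<δ
      M×upper = eventually-∀ λ x → Sw≤0 x δ 0<δ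
      N = proj₁ N×lower
      lower = proj₂ N×lower
      M = proj₁ M×upper
      upper = proj₂ M×upper

-- Integer form of the second-neighborhood matrix

module _ (D : Digraph) where
  open Digraph D

  -- Integer entries turn positivity into a bound by 1. Opacity keeps an entry atomic in later
  -- goals, without unfolding the path search in `dist?`.
  opaque
    sign : Vertex → Vertex → ℤ
    sign u v = if does (dist? D 1 u v) then 1ℤ else if does (dist? D 2 u v) then -1ℤ else 0ℤ

    seq-secondNeighborhoodMatrix : ∀ u v k →
      seq (secondNeighborhoodMatrix D u v) k ≡ fromℤ (sign u v)
    seq-secondNeighborhoodMatrix u v k = trans
      (cong (λ r → seq r k) (unfold u v))
      (cases (does (dist? D 1 u v)) (does (dist? D 2 u v)))
      where
      unfold : ∀ u v → secondNeighborhoodMatrix D u v ≡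
        (if does (dist? D 1 u v) then 1ℝ else if does (dist? D 2 u v) then - 1ℝ else 0ℝ)
      unfold u v = refl
      cases : ∀ b c → seq (if b then 1ℝ else if c then - 1ℝ else 0ℝ) k ≡
                      fromℤ (if b then 1ℤ else if c then -1ℤ else 0ℤ)
      cases true  _     = refl
      cases false true  = refl
      cases false false = refl

  outSum : Vertex → ℤ
  outSum u = ℤΣ.sum (sign u)

  𝒳₂₁⇒outSum≥1 : 𝒳₂₁ D → ∀ u → 1ℤ ℤ.≤ outSum u
  𝒳₂₁⇒outSum≥1 = S𝟏>𝟎⇒rowSum≥1 (secondNeighborhoodMatrix D) sign seq-secondNeighborhoodMatrix

  dual⇒𝒳₂₃ : (y : Vertex → ℤ) → (∀ u → 0ℤ ℤ.≤ y u) →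
    (∀ v → 1ℤ ℤ.≤ ℤΣ.sum (λ u → y u ℤ.* sign u v)) → 𝒳₂₃ D
  dual⇒𝒳₂₃ = yᵀS>𝟎⇒Sw≰𝟎 (secondNeighborhoodMatrix D) sign seq-secondNeighborhoodMatrix

-- Digraphs

module Entries (D : Digraph) where
  open Digraph D

  -- Shortest paths are replaced by arcs and two-step walks: asymmetry already keeps the ends of
  -- such a walk distinct. The diagonal falls under `far`.
  data Entry (u v : Vertex) : ℤ → Set where
    near   : u ⟶ v → Entry u v 1ℤ
    second : ∀ {w} → ¬ u ⟶ v → u ⟶ w → w ⟶ v → Entry u v -1ℤ
    far    : ¬ u ⟶ v → (∀ {w} → u ⟶ w → ¬ w ⟶ v) → Entry u v 0ℤ

  hasPath₀⇒≡ : ∀ {u v} → HasPath D 0 u v → u ≡ v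
  hasPath₀⇒≡ (_ ∷ [] , refl , refl , _) = refl

  hasPath₁⇒⟶ : ∀ {u v} → HasPath D 1 u v → u ⟶ v
  hasPath₁⇒⟶ (_ ∷ _ ∷ [] , refl , refl , u⟶v ∷ _ , _) = u⟶v

  ⟶⇒dist₁ : ∀ {u v} → u ⟶ v → Dist D 1 u v
  ⟶⇒dist₁ {u} {v} u⟶v =
    (u ∷ v ∷ [] , refl , refl , u⟶v ∷ [-] , ((λ u≡v → irrefl u≡v u⟶v) ∷ []) ∷ [] ∷ []) ,
    λ { {zero} _ p → irrefl (hasPath₀⇒≡ p) u⟶v ; {suc _} (s≤s ()) }

  ⟶⟶⇒dist₂ : ∀ {u v w} → ¬ u ⟶ v → u ⟶ w → w ⟶ v → Dist D 2 u v
  ⟶⟶⇒dist₂ {u} {v} {w} u↛v u⟶w w⟶v =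
    (u ∷ w ∷ v ∷ [] , refl , refl , u⟶w ∷ w⟶v ∷ [-] ,
      ((λ u≡w → irrefl u≡w u⟶w) ∷ u≢v ∷ []) ∷ ((λ w≡v → irrefl w≡v w⟶v) ∷ []) ∷ [] ∷ []) ,
    λ { {zero} _ p → u≢v (hasPath₀⇒≡ p)
      ; {suc zero} _ p → u↛v (hasPath₁⇒⟶ p)
      ; {suc (suc _)} (s≤s (s≤s ())) }
    where
    u≢v : u ≢ v
    u≢v refl = asym u⟶w w⟶v

  decsEntry : ∀ {u v} (d₁ : Dec (Dist D 1 u v)) (d₂ : Dec (Dist D 2 u v)) →
    Entry u v (if does d₁ then 1ℤ else if does d₂ then -1ℤ else 0ℤ)
  decsEntry (yes (p , _)) _ = near (hasPath₁⇒⟶ p)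
  decsEntry (no ¬d₁) (yes ((_ ∷ _ ∷ _ ∷ [] , refl , refl , u⟶w ∷ w⟶v ∷ _ , _) , _)) =
    second (¬d₁ ∘ ⟶⇒dist₁) u⟶w w⟶v
  decsEntry (no ¬d₁) (no ¬d₂) = far (¬d₁ ∘ ⟶⇒dist₁) λ u⟶w w⟶v →
    ¬d₂ (⟶⟶⇒dist₂ (¬d₁ ∘ ⟶⇒dist₁) u⟶w w⟶v)

  opaque
    unfolding sign

    entry : ∀ u v → Entry u v (sign D u v)
    entry u v = decsEntry (dist? D 1 u v) (dist? D 2 u v)

  entry≡1⇒⟶ : ∀ {u v z} → Entry u v z → z ≡ 1ℤ → u ⟶ v
  entry≡1⇒⟶ (near u⟶v) _ = u⟶v

  ⟶⇒entry≡1 : ∀ {u v z} → u ⟶ v → Entry u v z → z ≡ 1ℤ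
  ⟶⇒entry≡1 u⟶v (near _)         = refl
  ⟶⇒entry≡1 u⟶v (second u↛v _ _) = contradiction u⟶v u↛v
  ⟶⇒entry≡1 u⟶v (far u↛v _)      = contradiction u⟶v u↛v

  ⟶⟶⇒entry≢0 : ∀ {u v w z} → u ⟶ w → w ⟶ v → Entry u v z → z ≢ 0ℤ
  ⟶⟶⇒entry≢0 u⟶w w⟶v (far _ ↛) refl = ↛ u⟶w w⟶v

  entry-self : ∀ {u z} → Entry u u z → z ≡ 0ℤ
  entry-self (near u⟶u)           = contradiction u⟶u (irrefl refl)
  entry-self (second _ u⟶w w⟶u) = contradiction w⟶u (asym u⟶w)
  entry-self (far _ _)            = refl

  -1≤entry : ∀ {u v z} → Entry u v z → -1ℤ ℤ.≤ z
  -1≤entry (near _)       = ℤ.-≤+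
  -1≤entry (second _ _ _) = ℤ.≤-refl
  -1≤entry (far _ _)      = ℤ.-≤+

-- Counting arcs

lookup-injective : ∀ {A : Set} {xs : List A} → List.Unique xs → Injective _≡_ _≡_ (List.lookup xs)
lookup-injective (_  AllPairs.∷ _)   {zero}  {zero}  _  = refl
lookup-injective (x∉ AllPairs.∷ _)   {zero}  {suc j} eq = contradiction eq (All.lookup x∉ (∈-lookup j))
lookup-injective (x∉ AllPairs.∷ _)   {suc i} {zero}  eq = contradiction (sym eq) (All.lookup x∉ (∈-lookup i))
lookup-injective (_  AllPairs.∷ xs!) {suc i} {suc j} eq = cong suc (lookup-injective xs! eq)

-- Sending each position in `xs` to one in `ys` holding the same element is injective, because `xs`
-- has no repetitions.
unique∧⊆⇒length≤ : ∀ {A : Set} {xs ys : List A} →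
  List.Unique xs → (∀ {x} → x ∈ xs → x ∈ ys) → length xs ℕ.≤ length ys
unique∧⊆⇒length≤ {xs = xs} {ys} xs! xs⊆ys = Fin.injective⇒≤ {f = f} f-injective
  where
  f : Fin (length xs) → Fin (length ys)
  f i = Any.index (xs⊆ys (∈-lookup i))
  f-injective : Injective _≡_ _≡_ f
  f-injective {i} {j} fi≡fj = lookup-injective xs! (begin
    List.lookup xs i     ≡⟨ Any.lookup-index (xs⊆ys (∈-lookup i)) ⟩
    List.lookup ys (f i) ≡⟨ cong (List.lookup ys) fi≡fj ⟩
    List.lookup ys (f j) ≡⟨ Any.lookup-index (xs⊆ys (∈-lookup j)) ⟨
    List.lookup xs j     ∎)
    where open ≡-Reasoning

module _ (E : Digraph) where
  open Digraph E

  ⟶⇒∈arcs : ∀ {u v} → u ⟶ v → (u , v) ∈ arcs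
  ⟶⇒∈arcs {u} {v} = ∈-filter⁺ (λ (u , v) → u ⟶? v)
    (∈-cartesianProduct⁺ (∈-allFin u) (∈-allFin v))

  ∈arcs⇒⟶ : ∀ {u v} → (u , v) ∈ arcs → u ⟶ v
  ∈arcs⇒⟶ uv∈arcs = proj₂ (∈-filter⁻ (λ (u , v) → u ⟶? v)
    {xs = cartesianProduct (allFin order) (allFin order)} uv∈arcs)

  arcs-unique : List.Unique arcs
  arcs-unique = Unique.filter⁺ (λ (u , v) → u ⟶? v)
    (Unique.cartesianProduct⁺ (Unique.allFin⁺ order) (Unique.allFin⁺ order))

-- The reverse of the subdigraph of E induced by the image of φ, without the arc p ⟶ t.
module Reverse (E : Digraph) {m} {{_ : ℕ.NonZero m}}
  (φ : Fin m → Digraph.Vertex E) (φ-injective : Injective _≡_ _≡_ φ)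
  (p t : Digraph.Vertex E) (p⟶t : Digraph._⟶_ E p t) where
  open Digraph E

  reverse : Digraph
  reverse = record
    { order  = m
    ; _⟶_    = λ a b → φ b ⟶ φ a × ¬ (φ b ≡ p × φ a ≡ t)
    ; _⟶?_   = λ a b → (φ b ⟶? φ a) ×-dec ¬? ((φ b Fin.≟ p) ×-dec (φ a Fin.≟ t))
    ; irrefl = λ { refl (φa⟶φa , _) → irrefl refl φa⟶φa }
    ; asym   = λ (φb⟶φa , _) (φa⟶φb , _) → asym φb⟶φa φa⟶φb
    }

  -- Turned back, the arcs of `reverse` are distinct arcs of `E` other than `(p , t)`; adding that
  -- pair in front still gives distinct arcs of `E`, hence strictness.
  reverse-size< : Digraph.size reverse ℕ.< size
  reverse-size< = subst (ℕ._< size) (List.length-map φ² (Digraph.arcs reverse))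
    (unique∧⊆⇒length≤
      (All.¬Any⇒All¬ _ pt∉ AllPairs.∷ Unique.map⁺ φ²-injective (arcs-unique reverse))
      λ { (here refl) → ⟶⇒∈arcs E p⟶t ; (there ab∈) → ⊆arcs (∈-map⁻ φ² ab∈) })
    where
    φ² : Fin m × Fin m → Vertex × Vertex
    φ² (a , b) = φ b , φ a
    φ²-injective : ∀ {x y} → φ² x ≡ φ² y → x ≡ y
    φ²-injective eq = cong₂ _,_ (φ-injective (cong proj₂ eq)) (φ-injective (cong proj₁ eq))
    pt∉ : (p , t) ∉ List.map φ² (Digraph.arcs reverse)
    pt∉ pt∈ with (a , b) , ab∈ , eq ← ∈-map⁻ φ² pt∈ =
      proj₂ (∈arcs⇒⟶ reverse ab∈) (sym (cong proj₁ eq) , sym (cong proj₂ eq))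
    ⊆arcs : ∀ {x} → ∃ (λ y → y ∈ Digraph.arcs reverse × x ≡ φ² y) → x ∈ arcs
    ⊆arcs (_ , y∈ , refl) = ⟶⇒∈arcs E (proj₁ (∈arcs⇒⟶ reverse y∈))

  private
    module E = Entries E
    module R = Entries reverse

  -- A surviving arc keeps its entry 1, and an entry -1 cannot decrease. Removing vertices and arcs
  -- creates no two-step walk, so 0 cannot drop to -1.
  reverse-entry≥ : ∀ {a b z z′} → (φ b ⟶ φ a → ¬ (φ b ≡ p × φ a ≡ t)) →
    E.Entry (φ b) (φ a) z → R.Entry a b z′ → z ℤ.≤ z′
  reverse-entry≥ keep (E.near φb⟶φa)   e = ℤ.≤-reflexive (sym (R.⟶⇒entry≡1 (φb⟶φa , keep φb⟶φa) e))
  reverse-entry≥ keep (E.second _ _ _) e = R.-1≤entry e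
  reverse-entry≥ keep (E.far ↛ _)  (R.near (→′ , _))              = contradiction →′ ↛
  reverse-entry≥ keep (E.far _ ↛↛) (R.second _ (→₁ , _) (→₂ , _)) = contradiction →₁ (↛↛ →₂)
  reverse-entry≥ keep (E.far _ _)  (R.far _ _)                    = ℤ.≤-refl

-- Deleting an arc at a vertex of maximum out-degree

δ : ∀ {n} → Fin n → Fin n → ℤ
δ v w = if does (v Fin.≟ w) then 1ℤ else 0ℤ

δ-refl : ∀ {n} (v : Fin n) → δ v v ≡ 1ℤ
δ-refl v with v Fin.≟ v
... | yes _  = refl
... | no v≢v = contradiction refl v≢v

δ-≢ : ∀ {n} {v w : Fin n} → v ≢ w → δ v w ≡ 0ℤ
δ-≢ {v = v} {w} v≢w with v Fin.≟ w
... | yes v≡w = contradiction v≡w v≢w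
... | no _    = refl

ℤ-sum-zero : ∀ {n} {f : Vector ℤ n} → (∀ i → f i ≡ 0ℤ) → ℤΣ.sum f ≡ 0ℤ
ℤ-sum-zero {n} f≡0 = trans (ℤΣ.sum-cong-≗ f≡0) (ℤΣ.sum-replicate-zero n)

ℤ-sum-*δ : ∀ {n} (f : Vector ℤ n) v → ℤΣ.sum (λ w → f w ℤ.* δ v w) ≡ f v
ℤ-sum-*δ f zero = trans
  (cong₂ ℤ._+_ (ℤ.*-identityʳ (f zero)) (ℤ-sum-zero (λ w → ℤ.*-zeroʳ (f (suc w)))))
  (ℤ.+-identityʳ (f zero))
ℤ-sum-*δ f (suc v) = trans
  (cong₂ ℤ._+_ (ℤ.*-zeroʳ (f zero)) (ℤ-sum-*δ (f ∘ suc) v))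
  (ℤ.+-identityˡ (f (suc v)))

ℤ-sum-δ : ∀ {n} (v : Fin n) → ℤΣ.sum (δ v) ≡ 1ℤ
ℤ-sum-δ v = trans (ℤΣ.sum-cong-≗ (λ w → sym (ℤ.*-identityˡ (δ v w)))) (ℤ-sum-*δ (λ _ → 1ℤ) v)

1≤sum⇒1≤term : ∀ {n} {f : Vector ℤ n} → 1ℤ ℤ.≤ ℤΣ.sum f → ∃[ i ] 1ℤ ℤ.≤ f i
1≤sum⇒1≤term {n} {f} 1≤∑f with Fin.any? (λ i → 1ℤ ℤ.≤? f i)
... | yes found = found
... | no ¬found = contradiction 1≤∑f (ℤ.<⇒≱ (ℤ.≤-<-trans ∑f≤0 (ℤ.+<+ (s≤s z≤n))))
  where
  f≤0 : ∀ i → f i ℤ.≤ 0ℤ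
  f≤0 i = ℤ.i<j⇒i≤pred[j] (ℤ.≰⇒> (λ 1≤fi → ¬found (i , 1≤fi)))
  ∑f≤0 : ℤΣ.sum f ℤ.≤ 0ℤ
  ∑f≤0 = subst (ℤΣ.sum f ℤ.≤_) (ℤ-sum-zero {n} (λ _ → refl)) (ℤ-sum-mono-≤ f≤0)

-- Labels the vertices of an induced subdigraph by `Fin count`; `sum-at` transfers row sums to it
-- when nothing outside contributes.
record Enumeration {n} (P : Fin n → Set) : Set where
  field
    count      : ℕ
    at         : Fin count → Fin n
    injective  : Injective _≡_ _≡_ at
    sound      : ∀ a → P (at a)
    complete   : ∀ {i} → P i → ∃[ a ] at a ≡ i
    sum-at     : ∀ {f : Vector ℤ n} → (∀ {i} → ¬ P i → f i ≡ 0ℤ) → ℤΣ.sum (f ∘ at) ≡ ℤΣ.sum f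

enumerate : ∀ {n} {P : Fin n → Set} → (∀ i → Dec (P i)) → Enumeration P
enumerate {zero} P? = record
  { count = 0 ; at = λ () ; injective = λ { {()} } ; sound = λ ()
  ; complete = λ { {()} } ; sum-at = λ _ → refl }
enumerate {suc n} {P} P? = extend (P? zero) (enumerate (P? ∘ suc))
  where
  extend : Dec (P zero) → Enumeration (P ∘ suc) → Enumeration P
  extend (yes p₀) e = record
    { count      = suc count
    ; at        = at′
    ; injective = injective′
    ; sound     = λ { zero → p₀ ; (suc a) → sound a }
    ; complete  = λ { {zero} _ → zero , refl
                    ; {suc i} p → suc (proj₁ (complete p)) , cong suc (proj₂ (complete p)) }
    ; sum-at    = λ {f} f≡0 → cong (ℤ._+_ (f zero)) (sum-at f≡0)
    }
    where
    open Enumeration e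
    at′ : Fin (suc count) → Fin (suc n)
    at′ zero    = zero
    at′ (suc a) = suc (at a)
    injective′ : Injective _≡_ _≡_ at′
    injective′ {zero}  {zero}  _  = refl
    injective′ {suc a} {suc b} eq = cong suc (injective (Fin.suc-injective eq))
  extend (no ¬p₀) e = record
    { count      = count
    ; at        = suc ∘ at
    ; injective = injective ∘ Fin.suc-injective
    ; sound     = sound
    ; complete  = λ { {zero} p → contradiction p ¬p₀
                    ; {suc i} p → proj₁ (complete p) , cong suc (proj₂ (complete p)) }
    ; sum-at    = λ {f} f≡0 → trans (sum-at f≡0) (sym (trans
                    (cong (λ z → z ℤ.+ ℤΣ.sum (f ∘ suc)) (f≡0 ¬p₀)) (ℤ.+-identityˡ _)))
    }
    where open Enumeration e

-- Arithmetic of the values -1, 0 and 1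

data Trit : ℤ → Set where
  plus  : Trit 1ℤ
  minus : Trit -1ℤ
  null  : Trit 0ℤ

0≤*-nonNeg : ∀ {i j} → 0ℤ ℤ.≤ i → 0ℤ ℤ.≤ j → 0ℤ ℤ.≤ i ℤ.* j
0≤*-nonNeg {i} {j} 0≤i 0≤j = subst (ℤ._≤ i ℤ.* j) (ℤ.*-zeroʳ i)
  (ℤ.*-monoˡ-≤-nonNeg i {{ℤ.nonNegative 0≤i}} 0≤j)

-- For nonzero `b` the product is `a b + 1`, which is nonnegative and vanishes only for opposite
-- signs; the latter is `trit-opposite`.
trit-0≤ : ∀ {a b} → Trit a → Trit b → 0ℤ ℤ.≤ b ℤ.* (a ℤ.+ b)
trit-0≤ plus  plus  = ℤ.+≤+ z≤n
trit-0≤ plus  minus = ℤ.+≤+ z≤n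
trit-0≤ plus  null  = ℤ.+≤+ z≤n
trit-0≤ minus plus  = ℤ.+≤+ z≤n
trit-0≤ minus minus = ℤ.+≤+ z≤n
trit-0≤ minus null  = ℤ.+≤+ z≤n
trit-0≤ null  plus  = ℤ.+≤+ z≤n
trit-0≤ null  minus = ℤ.+≤+ z≤n
trit-0≤ null  null  = ℤ.+≤+ z≤n

trit-opposite : ∀ {a b} → Trit a → Trit b → b ≢ 0ℤ → b ℤ.* (a ℤ.+ b) ≡ 0ℤ → a ≡ ℤ.- b
trit-opposite plus  minus _ _ = refl
trit-opposite minus plus  _ _ = refl
trit-opposite _     null  0≢0 _ = contradiction refl 0≢0

trit-square : ∀ {a} → Trit a → a ≢ 0ℤ → a ℤ.* a ≡ 1ℤ
trit-square plus  _   = refl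
trit-square minus _   = refl
trit-square null  0≢0 = contradiction refl 0≢0

trit-square-0≤ : ∀ {a} → Trit a → 0ℤ ℤ.≤ a ℤ.* a
trit-square-0≤ plus  = ℤ.+≤+ z≤n
trit-square-0≤ minus = ℤ.+≤+ z≤n
trit-square-0≤ null  = ℤ.+≤+ z≤n

1≤trit⇒≡1 : ∀ {a} → Trit a → 1ℤ ℤ.≤ a → a ≡ 1ℤ
1≤trit⇒≡1 plus _ = refl
1≤trit⇒≡1 null (ℤ.+≤+ ())

-1≤trit : ∀ {a} → Trit a → -1ℤ ℤ.≤ a
-1≤trit plus  = ℤ.-≤+
-1≤trit minus = ℤ.≤-refl
-1≤trit null  = ℤ.-≤+

trit≤1 : ∀ {a} → Trit a → a ℤ.≤ 1ℤ
trit≤1 plus  = ℤ.≤-refl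
trit≤1 minus = ℤ.-≤+
trit≤1 null  = ℤ.+≤+ z≤n

module Signs (E : Digraph) where
  open Digraph E
  open Entries E

  s : Vertex → Vertex → ℤ
  s = sign E

  entry-trit : ∀ {x w z} → Entry x w z → Trit z
  entry-trit (near _)       = plus
  entry-trit (second _ _ _) = minus
  entry-trit (far _ _)      = null

  s-trit : ∀ x w → Trit (s x w)
  s-trit x w = entry-trit (entry x w)

  s≡1⇒⟶ : ∀ {x w} → s x w ≡ 1ℤ → x ⟶ w
  s≡1⇒⟶ {x} {w} = entry≡1⇒⟶ (entry x w)

  ⟶⇒s≡1 : ∀ {x w} → x ⟶ w → s x w ≡ 1ℤ
  ⟶⇒s≡1 {x} {w} x⟶w = ⟶⇒entry≡1 x⟶w (entry x w)

  ⟶⟶⇒s≢0 : ∀ {x w z} → x ⟶ w → w ⟶ z → s x z ≢ 0ℤ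
  ⟶⟶⇒s≢0 {x} {w} {z} x⟶w w⟶z = ⟶⟶⇒entry≢0 x⟶w w⟶z (entry x z)

  outNeighbour : ∀ {x} → 1ℤ ℤ.≤ outSum E x → ∃[ w ] x ⟶ w
  outNeighbour {x} 1≤r = let w , 1≤s = 1≤sum⇒1≤term 1≤r
                         in w , s≡1⇒⟶ (1≤trit⇒≡1 (s-trit x w) 1≤s)

  -- Truncation at 0 leaves 1 exactly at the out-neighbours. Counting in the integers lets this be
  -- combined with row sums.
  outDegree : Vertex → ℤ
  outDegree x = ℤΣ.sum (λ w → s x w ℤ.⊔ 0ℤ)

-- The dual certificate after deleting one arc

module Deletion (E : Digraph) (outSum≥1 : ∀ x → 1ℤ ℤ.≤ outSum E x)
  (u v : Digraph.Vertex E) (u⟶v : Digraph._⟶_ E u v) where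
  open Digraph E
  open Entries E
  open Signs E

  q : Vertex → ℤ
  q w = s u w ℤ.- (ℤ.+ 2) ℤ.* δ v w

  q[v]≡-1 : q v ≡ -1ℤ
  q[v]≡-1 = cong₂ (λ a b → a ℤ.- (ℤ.+ 2) ℤ.* b) (⟶⇒s≡1 u⟶v) (δ-refl v)

  q≡s : ∀ {w} → v ≢ w → q w ≡ s u w
  q≡s {w} v≢w = trans (cong (λ b → s u w ℤ.- (ℤ.+ 2) ℤ.* b) (δ-≢ v≢w)) (ℤ.+-identityʳ (s u w))

  q-trit : ∀ w → Trit (q w)
  q-trit w with v Fin.≟ w
  ... | yes refl = subst Trit (sym (cong (λ a → a ℤ.- (ℤ.+ 2)) (⟶⇒s≡1 u⟶v))) minus
  ... | no _     = subst Trit (sym (ℤ.+-identityʳ (s u w))) (s-trit u w)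

  s≢0⇒q≢0 : ∀ {w} → s u w ≢ 0ℤ → q w ≢ 0ℤ
  s≢0⇒q≢0 {w} s≢0 q≡0 = s≢0 (trans (sym (q≡s v≢w)) q≡0)
    where
    v≢w : v ≢ w
    v≢w refl with () ← trans (sym q[v]≡-1) q≡0

  -- The size of the support of `q`, whose entries are -1, 0 and 1.
  N : ℤ
  N = ℤΣ.sum (λ w → q w ℤ.* q w)

  -- The support of `q` contains `v` and any out-neighbour `w` of `v`, which is two steps from `u`.
  -- Subtracting `δ v` in `h` takes out the contribution of `v` and leaves that of `w`.
  2≤N : (ℤ.+ 2) ℤ.≤ N
  2≤N = ℤ.0≤i-j⇒j≤i (subst (0ℤ ℤ.≤_) (shift N)
    (ℤ.i≤j⇒0≤j-i (subst (1ℤ ℤ.≤_) sum-h (subst (ℤ._≤ ℤΣ.sum h) h[w]≡1 (ℤ-term≤sum 0≤h w)))))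
    where
    shift : ∀ N → (1ℤ ℤ.* N ℤ.+ -1ℤ ℤ.* 1ℤ ℤ.+ 0ℤ ℤ.* N ℤ.+ 0ℤ ℤ.* N) ℤ.- 1ℤ ≡ N ℤ.- (ℤ.+ 2)
    shift = ℤ.solve-∀
    w : Vertex
    w = proj₁ (outNeighbour (outSum≥1 v))
    v⟶w : v ⟶ w
    v⟶w = proj₂ (outNeighbour (outSum≥1 v))
    h : Vertex → ℤ
    h i = q i ℤ.* q i ℤ.- δ v i
    sum-h : ℤΣ.sum h ≡ 1ℤ ℤ.* N ℤ.+ -1ℤ ℤ.* 1ℤ ℤ.+ 0ℤ ℤ.* N ℤ.+ 0ℤ ℤ.* N
    sum-h = trans (ℤΣ.sum-cong-≗ λ i → expand (q i ℤ.* q i) (δ v i))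
      (trans (ℤ-sum-linear 1ℤ -1ℤ 0ℤ 0ℤ (λ i → q i ℤ.* q i) (δ v) (λ i → q i ℤ.* q i) (λ i → q i ℤ.* q i))
             (cong (λ z → 1ℤ ℤ.* N ℤ.+ -1ℤ ℤ.* z ℤ.+ 0ℤ ℤ.* N ℤ.+ 0ℤ ℤ.* N) (ℤ-sum-δ v)))
      where
      expand : ∀ a b → a ℤ.- b ≡ 1ℤ ℤ.* a ℤ.+ -1ℤ ℤ.* b ℤ.+ 0ℤ ℤ.* a ℤ.+ 0ℤ ℤ.* a
      expand = ℤ.solve-∀
    0≤h : ∀ i → 0ℤ ℤ.≤ h i
    0≤h i with v Fin.≟ i
    ... | yes refl rewrite ⟶⇒s≡1 u⟶v = ℤ.≤-refl
    ... | no v≢i   = subst (0ℤ ℤ.≤_) (sym (ℤ.+-identityʳ _))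
      (trit-square-0≤ (subst Trit (sym (ℤ.+-identityʳ (s u i))) (s-trit u i)))
    h[w]≡1 : h w ≡ 1ℤ
    h[w]≡1 = cong₂ ℤ._-_ (trit-square (q-trit w) (s≢0⇒q≢0 (⟶⟶⇒s≢0 u⟶v v⟶w)))
      (δ-≢ (λ v≡w → irrefl v≡w v⟶w))

  -- The last term adds 2 to the total of the altered row `q`, where `q v` is -1; without it that
  -- total could be -1. It costs any other row at most 2.
  y : Vertex → ℤ
  y w = ((ℤ.+ 2) ℤ.* N ℤ.+ 1ℤ) ℤ.+ (ℤ.+ 2) ℤ.* q w ℤ.- (ℤ.+ 2) ℤ.* δ v w

  0≤y : ∀ w → 0ℤ ℤ.≤ y w
  0≤y w = bound w (v Fin.≟ w)
    where
    0≤2[N-2] : 0ℤ ℤ.≤ (ℤ.+ 2) ℤ.* (N ℤ.- (ℤ.+ 2))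
    0≤2[N-2] = 0≤*-nonNeg {ℤ.+ 2} (ℤ.+≤+ z≤n) (ℤ.i≤j⇒0≤j-i 2≤N)
    bound : ∀ w → Dec (v ≡ w) → 0ℤ ℤ.≤ y w
    -- The weight is smallest at `v`, namely `2 N − 3`, which `2≤N` makes positive.
    bound w (yes refl) = subst (0ℤ ℤ.≤_)
      (trans (eq N) (sym (cong₂ (λ a b → ((ℤ.+ 2) ℤ.* N ℤ.+ 1ℤ) ℤ.+ (ℤ.+ 2) ℤ.* a ℤ.- (ℤ.+ 2) ℤ.* b) q[v]≡-1 (δ-refl v))))
      (ℤ.+-mono-≤ 0≤2[N-2] (ℤ.+≤+ (z≤n {1})))
      where
      eq : ∀ N → (ℤ.+ 2) ℤ.* (N ℤ.- (ℤ.+ 2)) ℤ.+ 1ℤ ≡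
        ((ℤ.+ 2) ℤ.* N ℤ.+ 1ℤ) ℤ.+ (ℤ.+ 2) ℤ.* -1ℤ ℤ.- (ℤ.+ 2) ℤ.* 1ℤ
      eq = ℤ.solve-∀
    bound w (no v≢w) = subst (0ℤ ℤ.≤_)
      (trans (eq N (q w)) (sym (cong (λ b → ((ℤ.+ 2) ℤ.* N ℤ.+ 1ℤ) ℤ.+ (ℤ.+ 2) ℤ.* q w ℤ.- (ℤ.+ 2) ℤ.* b) (δ-≢ v≢w))))
      (ℤ.+-mono-≤ (ℤ.+-mono-≤ 0≤2[N-2] (ℤ.+≤+ (z≤n {3})))
        (0≤*-nonNeg {ℤ.+ 2} (ℤ.+≤+ z≤n) (ℤ.i≤j⇒0≤j-i (-1≤trit (q-trit w)))))
      where
      eq : ∀ N a → (ℤ.+ 2) ℤ.* (N ℤ.- (ℤ.+ 2)) ℤ.+ (ℤ.+ 3) ℤ.+ (ℤ.+ 2) ℤ.* (a ℤ.- -1ℤ) ≡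
        ((ℤ.+ 2) ℤ.* N ℤ.+ 1ℤ) ℤ.+ (ℤ.+ 2) ℤ.* a ℤ.- (ℤ.+ 2) ℤ.* 0ℤ
      eq = ℤ.solve-∀

  sum-y* : ∀ (t : Vertex → ℤ) → ℤΣ.sum (λ w → y w ℤ.* t w) ≡
    ((ℤ.+ 2) ℤ.* N ℤ.+ 1ℤ) ℤ.* ℤΣ.sum t ℤ.+ (ℤ.+ 2) ℤ.* ℤΣ.sum (λ w → t w ℤ.* q w) ℤ.- (ℤ.+ 2) ℤ.* t v
  sum-y* t = trans (ℤΣ.sum-cong-≗ λ w → expand ((ℤ.+ 2) ℤ.* N ℤ.+ 1ℤ) (q w) (δ v w) (t w))
    (trans (ℤ-sum-linear ((ℤ.+ 2) ℤ.* N ℤ.+ 1ℤ) (ℤ.+ 2) (ℤ.- (ℤ.+ 2)) 0ℤ t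
              (λ w → t w ℤ.* q w) (λ w → t w ℤ.* δ v w) t)
      (trans (cong (λ z → ((ℤ.+ 2) ℤ.* N ℤ.+ 1ℤ) ℤ.* ℤΣ.sum t ℤ.+ (ℤ.+ 2) ℤ.* ℤΣ.sum (λ w → t w ℤ.* q w)
                          ℤ.+ (ℤ.- (ℤ.+ 2)) ℤ.* z ℤ.+ 0ℤ ℤ.* ℤΣ.sum t) (ℤ-sum-*δ t v))
             (collect ((ℤ.+ 2) ℤ.* N ℤ.+ 1ℤ) (ℤΣ.sum t) (ℤΣ.sum (λ w → t w ℤ.* q w)) (t v))))
    where
    expand : ∀ c a d b → (c ℤ.+ (ℤ.+ 2) ℤ.* a ℤ.- (ℤ.+ 2) ℤ.* d) ℤ.* b ≡
      c ℤ.* b ℤ.+ (ℤ.+ 2) ℤ.* (b ℤ.* a) ℤ.+ (ℤ.- (ℤ.+ 2)) ℤ.* (b ℤ.* d) ℤ.+ 0ℤ ℤ.* b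
    expand = ℤ.solve-∀
    collect : ∀ c a b d → c ℤ.* a ℤ.+ (ℤ.+ 2) ℤ.* b ℤ.+ (ℤ.- (ℤ.+ 2)) ℤ.* d ℤ.+ 0ℤ ℤ.* a ≡
      c ℤ.* a ℤ.+ (ℤ.+ 2) ℤ.* b ℤ.- (ℤ.+ 2) ℤ.* d
    collect = ℤ.solve-∀

  -- Summed over `w`, this measures how far `s x · q` lies above its least conceivable value `- N`.
  gap : Vertex → Vertex → ℤ
  gap x w = q w ℤ.* (s x w ℤ.+ q w)

  0≤gap : ∀ x w → 0ℤ ℤ.≤ gap x w
  0≤gap x w = trit-0≤ (s-trit x w) (q-trit w)

  sum-gap : ∀ x → ℤΣ.sum (gap x) ≡ ℤΣ.sum (λ w → s x w ℤ.* q w) ℤ.+ N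
  sum-gap x = trans (ℤΣ.sum-cong-≗ λ w → expand (s x w) (q w))
    (ℤΣ.∑-distrib-+ (λ w → s x w ℤ.* q w) (λ w → q w ℤ.* q w))
    where
    expand : ∀ a b → b ℤ.* (a ℤ.+ b) ≡ a ℤ.* b ℤ.+ b ℤ.* b
    expand = ℤ.solve-∀

  -- The first component says that row x equals − q on the support of q.
  Mirror : Vertex → Set
  Mirror x = ℤΣ.sum (gap x) ≡ 0ℤ × outSum E x ≡ 1ℤ

  mirror? : ∀ x → Dec (Mirror x)
  mirror? x = (ℤΣ.sum (gap x) ℤ.≟ 0ℤ) ×-dec (outSum E x ℤ.≟ 1ℤ)

  1+nonNeg : ∀ {i} → 0ℤ ℤ.≤ i → 1ℤ ℤ.≤ 1ℤ ℤ.+ i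
  1+nonNeg 0≤i = ℤ.+-monoʳ-≤ 1ℤ 0≤i

  0≤2N+1 : 0ℤ ℤ.≤ (ℤ.+ 2) ℤ.* N ℤ.+ 1ℤ
  0≤2N+1 = ℤ.+-mono-≤ (0≤*-nonNeg {ℤ.+ 2} (ℤ.+≤+ z≤n) (ℤ.≤-trans (ℤ.+≤+ z≤n) 2≤N)) (ℤ.+≤+ (z≤n {1}))

  -- With `r` the row sum and `P = s x · q`, the total is `(2 N + 1) r + 2 P − 2 s x v`, where
  -- `P ≥ − N` and `s x v ≤ 1`. If `r ≥ 2` it is at least `2 N`; if `P ≥ 1 − N` it is at least 1.
  -- `Mirror` is the failure of both.
  s-row≥1 : ∀ x → ¬ Mirror x → 1ℤ ℤ.≤ ℤΣ.sum (λ w → y w ℤ.* s x w)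
  s-row≥1 x ¬mirror = subst (1ℤ ℤ.≤_) (sym (sum-y* (s x))) (bound (ℤΣ.sum (gap x) ℤ.≟ 0ℤ))
    where
    r P : ℤ
    r = outSum E x
    P = ℤΣ.sum (λ w → s x w ℤ.* q w)
    0≤2[1-s] : 0ℤ ℤ.≤ (ℤ.+ 2) ℤ.* (1ℤ ℤ.- s x v)
    0≤2[1-s] = 0≤*-nonNeg {ℤ.+ 2} (ℤ.+≤+ z≤n) (ℤ.i≤j⇒0≤j-i (trit≤1 (s-trit x v)))
    bound : Dec (ℤΣ.sum (gap x) ≡ 0ℤ) →
      1ℤ ℤ.≤ ((ℤ.+ 2) ℤ.* N ℤ.+ 1ℤ) ℤ.* r ℤ.+ (ℤ.+ 2) ℤ.* P ℤ.- (ℤ.+ 2) ℤ.* s x v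
    bound (yes gap≡0) = subst (1ℤ ℤ.≤_) (eq N r P (s x v)) (1+nonNeg
      (ℤ.+-mono-≤ (ℤ.+-mono-≤ (ℤ.+-mono-≤
        (0≤*-nonNeg 0≤2N+1 (ℤ.i≤j⇒0≤j-i (ℤ.i<j⇒suc[i]≤j (ℤ.≤∧≢⇒< (outSum≥1 x) (λ 1≡r → ¬mirror (gap≡0 , sym 1≡r))))))
        (ℤ.+-mono-≤ (0≤*-nonNeg {ℤ.+ 2} (ℤ.+≤+ z≤n) (ℤ.i≤j⇒0≤j-i 2≤N)) (ℤ.+≤+ (z≤n {3}))))
        (0≤*-nonNeg {ℤ.+ 2} (ℤ.+≤+ z≤n) (subst (0ℤ ℤ.≤_) (sum-gap x) (ℤ-sum-nonNeg (0≤gap x)))))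
        0≤2[1-s]))
      where
      eq : ∀ N r P t → 1ℤ ℤ.+ (((ℤ.+ 2) ℤ.* N ℤ.+ 1ℤ) ℤ.* (r ℤ.- (ℤ.+ 2)) ℤ.+
          ((ℤ.+ 2) ℤ.* (N ℤ.- (ℤ.+ 2)) ℤ.+ (ℤ.+ 3)) ℤ.+ (ℤ.+ 2) ℤ.* (P ℤ.+ N) ℤ.+ (ℤ.+ 2) ℤ.* (1ℤ ℤ.- t)) ≡
        ((ℤ.+ 2) ℤ.* N ℤ.+ 1ℤ) ℤ.* r ℤ.+ (ℤ.+ 2) ℤ.* P ℤ.- (ℤ.+ 2) ℤ.* t
      eq = ℤ.solve-∀
    bound (no gap≢0) = subst (1ℤ ℤ.≤_) (eq N r P (s x v)) (1+nonNeg
      (ℤ.+-mono-≤ (ℤ.+-mono-≤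
        (0≤*-nonNeg 0≤2N+1 (ℤ.i≤j⇒0≤j-i (outSum≥1 x)))
        (0≤*-nonNeg {ℤ.+ 2} (ℤ.+≤+ z≤n) (ℤ.i≤j⇒0≤j-i (subst (1ℤ ℤ.≤_) (sum-gap x)
          (ℤ.i<j⇒suc[i]≤j (ℤ.≤∧≢⇒< (ℤ-sum-nonNeg (0≤gap x)) (λ 0≡gap → gap≢0 (sym 0≡gap))))))))
        0≤2[1-s]))
      where
      eq : ∀ N r P t → 1ℤ ℤ.+ (((ℤ.+ 2) ℤ.* N ℤ.+ 1ℤ) ℤ.* (r ℤ.- 1ℤ) ℤ.+
          (ℤ.+ 2) ℤ.* (P ℤ.+ N ℤ.- 1ℤ) ℤ.+ (ℤ.+ 2) ℤ.* (1ℤ ℤ.- t)) ≡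
        ((ℤ.+ 2) ℤ.* N ℤ.+ 1ℤ) ℤ.* r ℤ.+ (ℤ.+ 2) ℤ.* P ℤ.- (ℤ.+ 2) ℤ.* t
      eq = ℤ.solve-∀

  -- The entries of `q` sum to at least -1, losing at most `2 N + 1`; the other two terms contribute
  -- `2 N` and 2.
  q-row≥1 : 1ℤ ℤ.≤ ℤΣ.sum (λ w → y w ℤ.* q w)
  q-row≥1 = subst (1ℤ ℤ.≤_) (sym (begin
      ℤΣ.sum (λ w → y w ℤ.* q w)
        ≡⟨ sum-y* q ⟩
      ((ℤ.+ 2) ℤ.* N ℤ.+ 1ℤ) ℤ.* ℤΣ.sum q ℤ.+ (ℤ.+ 2) ℤ.* N ℤ.- (ℤ.+ 2) ℤ.* q v
        ≡⟨ cong₂ (λ a b → ((ℤ.+ 2) ℤ.* N ℤ.+ 1ℤ) ℤ.* a ℤ.+ (ℤ.+ 2) ℤ.* N ℤ.- (ℤ.+ 2) ℤ.* b) sum-q q[v]≡-1 ⟩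
      ((ℤ.+ 2) ℤ.* N ℤ.+ 1ℤ) ℤ.* (outSum E u ℤ.- (ℤ.+ 2)) ℤ.+ (ℤ.+ 2) ℤ.* N ℤ.- (ℤ.+ 2) ℤ.* -1ℤ
        ≡⟨ eq N (outSum E u) ⟩
      1ℤ ℤ.+ ((ℤ.+ 2) ℤ.* N ℤ.+ 1ℤ) ℤ.* (outSum E u ℤ.- 1ℤ) ∎))
    (1+nonNeg (0≤*-nonNeg 0≤2N+1 (ℤ.i≤j⇒0≤j-i (outSum≥1 u))))
    where
    open ≡-Reasoning
    sum-q : ℤΣ.sum q ≡ outSum E u ℤ.- (ℤ.+ 2)
    sum-q = begin
      ℤΣ.sum q
        ≡⟨ ℤΣ.sum-cong-≗ (λ w → expand (s u w) (δ v w)) ⟩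
      ℤΣ.sum (λ w → s u w ℤ.+ (ℤ.- (ℤ.+ 2)) ℤ.* δ v w)
        ≡⟨ ℤΣ.∑-distrib-+ (s u) (λ w → (ℤ.- (ℤ.+ 2)) ℤ.* δ v w) ⟩
      outSum E u ℤ.+ ℤΣ.sum (λ w → (ℤ.- (ℤ.+ 2)) ℤ.* δ v w)
        ≡⟨ cong (ℤ._+_ (outSum E u)) (ℤ-sum-*δ (λ _ → ℤ.- (ℤ.+ 2)) v) ⟩
      outSum E u ℤ.- (ℤ.+ 2) ∎
      where
      expand : ∀ a b → a ℤ.- (ℤ.+ 2) ℤ.* b ≡ a ℤ.+ (ℤ.- (ℤ.+ 2)) ℤ.* b
      expand = ℤ.solve-∀
    eq : ∀ N r → ((ℤ.+ 2) ℤ.* N ℤ.+ 1ℤ) ℤ.* (r ℤ.- (ℤ.+ 2)) ℤ.+ (ℤ.+ 2) ℤ.* N ℤ.- (ℤ.+ 2) ℤ.* -1ℤ ≡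
      1ℤ ℤ.+ ((ℤ.+ 2) ℤ.* N ℤ.+ 1ℤ) ℤ.* (r ℤ.- 1ℤ)
    eq = ℤ.solve-∀

  SmallerMember : Set₁
  SmallerMember = ∃[ F ] (𝒳₂₃ F × SmallerThan F E)

  noMirror⇒smaller : (∀ x → ¬ Mirror x) → SmallerMember
  noMirror⇒smaller ¬mirror = reverse , dual⇒𝒳₂₃ reverse y 0≤y column≥1 , reverse-size<
    where
    open Reverse E id id u v u⟶v
    module R = Entries reverse
    weighted : ∀ {t : Vertex → ℤ} b → (∀ a → t a ℤ.≤ sign reverse a b) →
      ℤΣ.sum (λ a → y a ℤ.* t a) ℤ.≤ ℤΣ.sum (λ a → y a ℤ.* sign reverse a b)
    weighted b t≤ = ℤ-sum-mono-≤ λ a → ℤ.*-monoˡ-≤-nonNeg (y a) {{ℤ.nonNegative (0≤y a)}} (t≤ a)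
    q≤ : ∀ a → q a ℤ.≤ sign reverse a u
    q≤ a = bound (v Fin.≟ a)
      where
      bound : Dec (v ≡ a) → q a ℤ.≤ sign reverse a u
      -- Without the arc the entry from `u` to `v` may be 0 or -1; `q` takes the safe value -1,
      -- whence its coefficient 2.
      bound (yes refl) = ℤ.≤-trans (ℤ.≤-reflexive q[v]≡-1) (R.-1≤entry (R.entry v u))
      bound (no v≢a)   = ℤ.≤-trans (ℤ.≤-reflexive (q≡s v≢a))
        (reverse-entry≥ (λ _ (_ , a≡v) → v≢a (sym a≡v)) (entry u a) (R.entry a u))
    column≥1 : ∀ b → 1ℤ ℤ.≤ ℤΣ.sum (λ a → y a ℤ.* sign reverse a b)
    column≥1 b = cases (b Fin.≟ u)
      where
      cases : Dec (b ≡ u) → 1ℤ ℤ.≤ ℤΣ.sum (λ a → y a ℤ.* sign reverse a b)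
      cases (yes refl) = ℤ.≤-trans q-row≥1 (weighted u q≤)
      -- Reversal turns columns into rows of `E`, and for `b` other than `u` all arcs leaving `b`
      -- survive.
      cases (no b≢u)   = ℤ.≤-trans (s-row≥1 b (¬mirror b)) (weighted b λ a →
        reverse-entry≥ (λ _ (b≡u , _) → b≢u b≡u) (entry b a) (R.entry a b))

  -- The closed subdigraph at a mirror vertex

  module _ (x : Vertex) (mirror : Mirror x) (deg≤ : outDegree x ℤ.≤ outDegree u) where

    gap≡0 : ∀ w → gap x w ≡ 0ℤ
    gap≡0 w = ℤ.≤-antisym (ℤ.≤-trans (ℤ-term≤sum (0≤gap x) w) (ℤ.≤-reflexive (proj₁ mirror))) (0≤gap x w)

    s≡-q : ∀ {w} → q w ≢ 0ℤ → s x w ≡ ℤ.- q w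
    s≡-q {w} q≢0 = trit-opposite (s-trit x w) (q-trit w) q≢0 (gap≡0 w)

    s[x,v]≡1 : s x v ≡ 1ℤ
    s[x,v]≡1 = trans (s≡-q λ q≡0 → contradiction (trans (sym q[v]≡-1) q≡0) λ ())
                     (cong (λ z → ℤ.- z) q[v]≡-1)

    x⟶v : x ⟶ v
    x⟶v = s≡1⇒⟶ s[x,v]≡1

    -- The difference `(s x w ⊔ 0) − s x w` is the indicator of the second out-neighbours of `x`;
    -- from it the indicator of the out-neighbours of `u` other than `v` is subtracted. Row sum 1
    -- means that `x` has one second out-neighbour fewer than out-neighbours, so the total is a
    -- difference of out-degrees.
    excess : Vertex → ℤ
    excess w = (s x w ℤ.⊔ 0ℤ) ℤ.- s x w ℤ.- (s u w ℤ.⊔ 0ℤ) ℤ.+ δ v w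

    sum-excess : ℤΣ.sum excess ≡ outDegree x ℤ.- outDegree u
    sum-excess = begin
      ℤΣ.sum excess
        ≡⟨ ℤΣ.sum-cong-≗ (λ w → expand (s x w ℤ.⊔ 0ℤ) (s x w) (s u w ℤ.⊔ 0ℤ) (δ v w)) ⟩
      _
        ≡⟨ ℤ-sum-linear 1ℤ -1ℤ -1ℤ 1ℤ (λ w → s x w ℤ.⊔ 0ℤ) (s x) (λ w → s u w ℤ.⊔ 0ℤ) (δ v) ⟩
      1ℤ ℤ.* outDegree x ℤ.+ -1ℤ ℤ.* outSum E x ℤ.+ -1ℤ ℤ.* outDegree u ℤ.+ 1ℤ ℤ.* ℤΣ.sum (δ v)
        ≡⟨ cong₂ (λ a b → 1ℤ ℤ.* outDegree x ℤ.+ -1ℤ ℤ.* a ℤ.+ -1ℤ ℤ.* outDegree u ℤ.+ 1ℤ ℤ.* b)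
             (proj₂ mirror) (ℤ-sum-δ v) ⟩
      1ℤ ℤ.* outDegree x ℤ.+ -1ℤ ℤ.* 1ℤ ℤ.+ -1ℤ ℤ.* outDegree u ℤ.+ 1ℤ ℤ.* 1ℤ
        ≡⟨ collect (outDegree x) (outDegree u) ⟩
      outDegree x ℤ.- outDegree u ∎
      where
      open ≡-Reasoning
      expand : ∀ a b c d → a ℤ.- b ℤ.- c ℤ.+ d ≡ 1ℤ ℤ.* a ℤ.+ -1ℤ ℤ.* b ℤ.+ -1ℤ ℤ.* c ℤ.+ 1ℤ ℤ.* d
      expand = ℤ.solve-∀
      collect : ∀ a b → 1ℤ ℤ.* a ℤ.+ -1ℤ ℤ.* 1ℤ ℤ.+ -1ℤ ℤ.* b ℤ.+ 1ℤ ℤ.* 1ℤ ≡ a ℤ.- b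
      collect = ℤ.solve-∀

    excess-v : excess v ≡ 0ℤ
    excess-v rewrite s[x,v]≡1 | ⟶⇒s≡1 u⟶v | δ-refl v = refl

    excess-≢ : ∀ {w} → v ≢ w → excess w ≡ (s x w ℤ.⊔ 0ℤ) ℤ.- s x w ℤ.- (s u w ℤ.⊔ 0ℤ)
    excess-≢ {w} v≢w = trans (cong (ℤ._+_ ((s x w ℤ.⊔ 0ℤ) ℤ.- s x w ℤ.- (s u w ℤ.⊔ 0ℤ))) (δ-≢ v≢w))
      (ℤ.+-identityʳ _)

    -- An out-neighbour of `u` other than `v` has `q w = 1`, hence is a second out-neighbour of `x`.
    0≤excess : ∀ w → 0ℤ ℤ.≤ excess w
    0≤excess w = bound (v Fin.≟ w)
      where
      nonNeg : ∀ {a b} → Trit a → Trit b → (b ≢ 0ℤ → a ≡ ℤ.- b) →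
        0ℤ ℤ.≤ (a ℤ.⊔ 0ℤ) ℤ.- a ℤ.- (b ℤ.⊔ 0ℤ)
      nonNeg plus  plus  opp = contradiction (opp λ ()) λ ()
      nonNeg null  plus  opp = contradiction (opp λ ()) λ ()
      nonNeg minus plus  _ = ℤ.+≤+ z≤n
      nonNeg plus  minus _ = ℤ.+≤+ z≤n
      nonNeg minus minus _ = ℤ.+≤+ z≤n
      nonNeg null  minus _ = ℤ.+≤+ z≤n
      nonNeg plus  null  _ = ℤ.+≤+ z≤n
      nonNeg minus null  _ = ℤ.+≤+ z≤n
      nonNeg null  null  _ = ℤ.+≤+ z≤n
      bound : Dec (v ≡ w) → 0ℤ ℤ.≤ excess w
      bound (yes refl) = ℤ.≤-reflexive (sym excess-v)
      bound (no v≢w)   = subst (0ℤ ℤ.≤_) (sym (excess-≢ v≢w)) (nonNeg (s-trit x w) (s-trit u w)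
        λ s≢0 → trans (s≡-q (s≢0⇒q≢0 s≢0)) (cong (λ z → ℤ.- z) (q≡s v≢w)))

    -- Equality in the count: since x has no more out-neighbours than u, its
    -- second out-neighbours are exactly the out-neighbours of u other than v.
    s[x]≡-1⇒s[u]≡1 : ∀ {w} → s x w ≡ -1ℤ → s u w ≡ 1ℤ
    s[x]≡-1⇒s[u]≡1 {w} s≡-1 = forced (s-trit u w) (subst (ℤ._≤ 0ℤ) excess-w excess≤0)
      where
      v≢w : v ≢ w
      v≢w refl with () ← trans (sym s[x,v]≡1) s≡-1
      excess-w : excess w ≡ 1ℤ ℤ.- (s u w ℤ.⊔ 0ℤ)
      excess-w = trans (excess-≢ v≢w) (cong (λ a → (a ℤ.⊔ 0ℤ) ℤ.- a ℤ.- (s u w ℤ.⊔ 0ℤ)) s≡-1)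
      excess≤0 : excess w ℤ.≤ 0ℤ
      excess≤0 = ℤ.≤-trans (ℤ-term≤sum 0≤excess w)
        (subst (ℤ._≤ 0ℤ) (sym sum-excess) (ℤ.i≤j⇒i-j≤0 deg≤))
      forced : ∀ {a} → Trit a → 1ℤ ℤ.- (a ℤ.⊔ 0ℤ) ℤ.≤ 0ℤ → a ≡ 1ℤ
      forced plus  _ = refl
      forced minus (ℤ.+≤+ ())
      forced null  (ℤ.+≤+ ())

    Near : Vertex → Set
    Near w = s x w ≢ 0ℤ

    -- One arc beyond an out-neighbour of `x` is still within two steps. A second out-neighbour of
    -- `x` is an out-neighbour of `u`, so `z` lies in the support of `q`, where row `x` is the
    -- negative of `q`.
    near-closed : ∀ {w z} → Near w → w ⟶ z → Near z
    near-closed {w} {z} near-w w⟶z = step (s-trit x w) refl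
      where
      step : ∀ {a} → Trit a → s x w ≡ a → Near z
      step plus  s≡1  = ⟶⟶⇒s≢0 (s≡1⇒⟶ s≡1) w⟶z
      step null  s≡0  = contradiction s≡0 near-w
      step minus s≡-1 s≡0 = q≢0 (trans (sym (ℤ.neg-involutive (q z)))
        (cong (λ a → ℤ.- a) (trans (sym (s≡-q q≢0)) s≡0)))
        where
        q≢0 : q z ≢ 0ℤ
        q≢0 = s≢0⇒q≢0 (⟶⟶⇒s≢0 (s≡1⇒⟶ (s[x]≡-1⇒s[u]≡1 s≡-1)) w⟶z)

    mirror⇒smaller : SmallerMember
    mirror⇒smaller = reverse , dual⇒𝒳₂₃ reverse (λ _ → 1ℤ) (λ _ → ℤ.+≤+ z≤n) column≥1 , reverse-size<
      where
      open Enumeration (enumerate {P = Near} (λ w → ¬? (s x w ℤ.≟ 0ℤ)))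
      instance
        nonEmpty′ : ℕ.NonZero count
        nonEmpty′ = Fin.nonZeroIndex (proj₁ (complete {v} λ s≡0 → contradiction (trans (sym s[x,v]≡1) s≡0) λ ()))
      -- As `s x x` is 0, `x` lies outside the image of `at`. Naming `x ⟶ v` as the removed arc thus
      -- deletes nothing further, and makes `reverse-size<` strict.
      open Reverse E at injective x v x⟶v
      module R = Entries reverse
      vanish : ∀ b {w z} → ¬ Near w → Entry (at b) w z → z ≡ 0ℤ
      vanish b ¬near (near b⟶w)         = contradiction (near-closed (sound b) b⟶w) ¬near
      vanish b ¬near (second _ b⟶c c⟶w) = contradiction (near-closed (near-closed (sound b) b⟶c) c⟶w) ¬near
      vanish b ¬near (far _ _)            = refl
      column≥1 : ∀ b → 1ℤ ℤ.≤ ℤΣ.sum (λ a → 1ℤ ℤ.* sign reverse a b)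
      column≥1 b = begin
        1ℤ
          ≤⟨ outSum≥1 (at b) ⟩
        ℤΣ.sum (s (at b))
          ≡⟨ sum-at (λ {w} ¬near → vanish b ¬near (entry (at b) w)) ⟨
        ℤΣ.sum (λ a → s (at b) (at a))
          ≤⟨ ℤ-sum-mono-≤ (λ a → reverse-entry≥ (λ _ (b≡x , _) →
               sound b (subst (λ w → s x w ≡ 0ℤ) (sym b≡x) (entry-self (entry x x))))
               (entry (at b) (at a)) (R.entry a b)) ⟩
        ℤΣ.sum (λ a → sign reverse a b)
          ≡⟨ ℤΣ.sum-cong-≗ (λ a → sym (ℤ.*-identityˡ (sign reverse a b))) ⟩
        ℤΣ.sum (λ a → 1ℤ ℤ.* sign reverse a b) ∎
        where open ℤ.≤-Reasoning

-- Comparison of minimal members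

𝒳₂₁⇒smaller-𝒳₂₃ : ∀ E → 𝒳₂₁ E → ∃[ F ] (𝒳₂₃ F × SmallerThan F E)
𝒳₂₁⇒smaller-𝒳₂₃ E E∈𝒳₂₁ = cases (Fin.any? mirror?)
  where
  open Digraph E
  outSum≥1 : ∀ x → 1ℤ ℤ.≤ outSum E x
  outSum≥1 = 𝒳₂₁⇒outSum≥1 E E∈𝒳₂₁
  open Signs E
  default u v : Vertex
  -- Any vertex can start the search for the maximum, since the list searched contains them all.
  default = Fin.fromℕ< (ℕ.>-nonZero⁻¹ order)
  u = Extrema.argmax outDegree default (allFin order)
  u-max : ∀ x → outDegree x ℤ.≤ outDegree u
  u-max x = All.lookup (Extrema.f[xs]≤f[argmax] default (allFin order)) (∈-allFin x)
  v = proj₁ (outNeighbour (outSum≥1 u))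
  u⟶v : u ⟶ v
  u⟶v = proj₂ (outNeighbour (outSum≥1 u))
  open Deletion E outSum≥1 u v u⟶v
  cases : Dec (∃ Mirror) → SmallerMember
  cases (yes (x , mirror)) = mirror⇒smaller x mirror (u-max x)
  cases (no ¬mirror)       = noMirror⇒smaller λ x mirror → ¬mirror (x , mirror)

theorem2p7 : ∀ (D E : Digraph) → Minimal 𝒳₂₃ D → Minimal 𝒳₂₁ E → SmallerThan D E
theorem2p7 D E (_ , D-min) (E∈𝒳₂₁ , _) =
  let F , F∈𝒳₂₃ , F<E = 𝒳₂₁⇒smaller-𝒳₂₃ E E∈𝒳₂₁
  in ℕ.≤-<-trans (D-min F F∈𝒳₂₃) F<E
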